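{- Let $T=\{2143,3142,3412\}$ and let $F_T(x)=\sum_{n\ge0}|S_n(T)|x^n$. Then $$F_T(x)=\frac{(1-3x)C(x)}{1-2x-x(1-x)C(x)},$$ where $C(x)=\frac{1-\sqrt{1-4x}}{2x}$.
   Context: $S_n$ is the set of permutations of $[n]$ ($S_0$ contains the empty permutation). A permutation avoids a pattern $\tau$ if it has no subsequence order-isomorphic to $\tau$; $S_n(T)$ is the set of permutations in $S_n$ avoiding every pattern in $T$. $C(x)$ is the Catalan generating function. -}

module Defs where

open import Data.Nat as ℕ using (ℕ; zero; suc; _∸_)
open import Data.Nat.Combinatorics using (_C_)
open import Data.Nat.DivMod using (_/_)
open import Data.Integer as ℤ using (ℤ; +_)
open import Data.List using (List; []; _∷_; length; zip; map; foldr; upTo)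
open import Data.List.Relation.Unary.All using (All)
open import Data.List.Relation.Unary.Unique.Propositional using (Unique)
open import Data.List.Membership.Propositional using (_∈_)
open import Data.List.Relation.Binary.Sublist.Propositional using (_⊆_)
open import Data.Product using (Σ; _×_; proj₁; proj₂; ∃)
open import Relation.Binary.PropositionalEquality using (_≡_)
open import Relation.Nullary using (¬_)
open import Function.Bundles using (_⇔_)

-- Permutations and pattern avoidance
--
-- A permutation of [n] is represented by its one-line notation as a list
-- of naturals, using the values 0,…,n-1 (i.e. [n] shifted down by one;
-- this does not affect order-isomorphism).

IsPerm : ℕ → List ℕ → Set
IsPerm n σ = (length σ ≡ n) × Unique σ × All (ℕ._< n) σ

OrderIso : List ℕ → List ℕ → Set
OrderIso s τ =
  (length s ≡ length τ) ×
  (∀ p q → p ∈ zip s τ → q ∈ zip s τ →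
     ((proj₁ p ℕ.< proj₁ q) ⇔ (proj₂ p ℕ.< proj₂ q)))

Contains : List ℕ → List ℕ → Set
Contains σ τ = ∃ λ s → (s ⊆ σ) × OrderIso s τ

Avoids : List ℕ → List ℕ → Set
Avoids σ τ = ¬ Contains σ τ

InSnT : ℕ → List ℕ → Set
InSnT n σ = IsPerm n σ
          × Avoids σ (2 ∷ 1 ∷ 4 ∷ 3 ∷ [])
          × Avoids σ (3 ∷ 1 ∷ 4 ∷ 2 ∷ [])
          × Avoids σ (3 ∷ 4 ∷ 1 ∷ 2 ∷ [])

CardSnT : ℕ → ℕ → Set
CardSnT n k = Σ (List (List ℕ)) λ L →
  Unique L × (∀ σ → (σ ∈ L) ⇔ InSnT n σ) × (length L ≡ k)

Series : Set
Series = ℕ → ℤ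

_⊕_ : Series → Series → Series
(f ⊕ g) n = f n ℤ.+ g n

_⊖_ : Series → Series → Series
(f ⊖ g) n = f n ℤ.- g n

_⊛_ : Series → Series → Series
(f ⊛ g) n = foldr ℤ._+_ (+ 0) (map (λ k → f k ℤ.* g (n ∸ k)) (upTo (suc n)))

const : ℤ → Series
const c zero    = c
const c (suc _) = + 0

X : Series
X 1 = + 1
X _ = + 0

catalan : ℕ → ℕ
catalan n = ((2 ℕ.* n) C n) / suc n

Cat : Series
Cat n = + catalan n

ofℕ : (ℕ → ℕ) → Series
ofℕ a n = + a n

{-# OPTIONS --safe #-}
module Submission where

open import Defs
open import Data.Nat using (ℕ)
open import Data.Integer using (+_)
open import Data.Product using (Σ; _×_)
open import Relation.Binary.PropositionalEquality using (_≡_)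

-- Identify σ with its diagram {(i , σᵢ)}.  The set T is invariant under a
-- quarter turn of the diagram.  Let h(n,m) be the number of avoiders of
-- length n+1 whose maximum is in position m and preceded by an increasing
-- run; after a quarter turn these are the avoiders whose first entry is m
-- and whose entries below m decrease.  For m ≥ 1, split the former by
-- their first entry.  Deleting it leaves an object of the same kind or,
-- when the run has length one, of the rotated kind, and counting those
-- with first entry at least r by downward induction on r gives
--   h(n,m) = h(n-1,m-1) + h(n,m+1),
-- so Σₙ h(n,m) xⁿ = (x C(x))ᵐ F(x), where h(n,0) is the number of avoiders
-- of length n and F = F_T.
--
-- An avoider with an ascent below its first entry starts with its
-- maximum, or ends with its maximum or minimum; removing that entry gives
-- a linear recurrence for the number of these avoiders.  All other
-- nonempty avoiders of length n are counted by h(n,1).  Together this is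
-- (1-2x)(F - xCF) - x(1-x)F = 1-3x, and multiplying by C = 1 + xC² gives
-- the formula for F.
import Data.Nat.Properties as ℕₚ
open import Data.Empty using (⊥; ⊥-elim)
import Data.Integer.Base as ℤ
open import Data.Integer.Base using (ℤ)
import Data.Integer.Properties as ℤₚ
import Data.Integer.Tactic.RingSolver as ℤ-Solver
import Data.List.Base as List
open import Data.List.Base
  using (List; []; _∷_; length; map; filter; foldr; applyUpTo; downFrom; _++_; zip;
         initLast; _∷ʳ′_)
open import Data.List.Membership.DecPropositional ℕₚ._≟_ using (_∈?_)
open import Data.List.Membership.Propositional using (_∈_; find)
open import Data.List.Membership.Propositional.Properties
  using (∈-map⁺; ∈-map⁻; ∈-filter⁺; ∈-filter⁻; ∈-++⁺ˡ; ∈-++⁺ʳ; ∈-++⁻; ∈-∃++; ∈-upTo⁺)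
import Data.List.Properties as Listₚ
open import Data.List.Relation.Binary.Sublist.Propositional using (_⊆_; []; _∷_; _∷ʳ_; minimum)
open import Data.List.Relation.Unary.All as All using (All; []; _∷_)
import Data.List.Relation.Unary.All.Properties as Allₚ
open import Data.List.Relation.Unary.AllPairs using ([]; _∷_)
open import Data.List.Relation.Unary.Any using (here; there)
open import Data.List.Relation.Unary.Unique.Propositional using (Unique)
import Data.List.Relation.Unary.Unique.Propositional.Properties as Uniqueₚ
import Data.Nat.Base as ℕ
open import Data.Nat.Base using (zero; suc; z≤n; s≤s; z<s; s<s; _∸_; _≤_; _<_; _+_)
open import Data.Nat.Combinatorics
  using (_C_; nCk+nC[k+1]≡[n+1]C[k+1]; nCk≡nC[n∸k]; nC1≡n)
open import Data.Nat.DivMod using (_/_; m*n/n≡m; /-congˡ)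
import Data.Nat.Tactic.RingSolver as ℕ-Solver
open import Data.Product using (∃; _,_; proj₁; proj₂; map₂)
open import Data.Sum.Base using (_⊎_; inj₁; inj₂; [_,_]′)
open import Function.Base using (id; _∘_)
open import Function.Bundles using (_⇔_; mk⇔; Equivalence)
open import Relation.Binary.Definitions using (tri<; tri≈; tri>)
open import Relation.Binary.PropositionalEquality
  using (_≢_; _≗_; refl; sym; trans; cong; cong₂; subst; module ≡-Reasoning)
open import Relation.Nullary using (¬_; Dec; yes; no; contradiction)
open import Relation.Nullary.Decidable using (¬?; _→-dec_)
open import Relation.Unary using (Decidable)

open Equivalence using (to; from)

-- Convolution of power series.

conv : Series → Series → Series
conv f g zero    = f 0 ℤ.* g 0
conv f g (suc n) = f 0 ℤ.* g (suc n) ℤ.+ conv (f ∘ suc) g n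

-- The folded sum is traded for a recursion that peels off the head of the first factor, so that the
-- later identities follow by induction on the coefficient with `f` varying.
⊛≗conv : ∀ f g → f ⊛ g ≗ conv f g
⊛≗conv f g n = trans (cong (foldr ℤ._+_ (+ 0)) (Listₚ.map-applyUpTo id (λ k → f k ℤ.* g (n ∸ k)) (suc n)))
                       (go f n)
  where
  go : ∀ f n → foldr ℤ._+_ (+ 0) (applyUpTo (λ k → f k ℤ.* g (n ∸ k)) (suc n)) ≡ conv f g n
  go f zero    = ℤₚ.+-identityʳ _
  go f (suc n) = cong (ℤ._+_ (f 0 ℤ.* g (suc n))) (go (f ∘ suc) n)

conv-cong : ∀ {f f′ g g′} → f ≗ f′ → g ≗ g′ → conv f g ≗ conv f′ g′
conv-cong p q zero    = cong₂ ℤ._*_ (p 0) (q 0)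
conv-cong p q (suc n) =
  cong₂ ℤ._+_ (cong₂ ℤ._*_ (p 0) (q (suc n))) (conv-cong (p ∘ suc) q n)

conv-⊖ʳ : ∀ f g h → conv f (g ⊖ h) ≗ conv f g ⊖ conv f h
conv-⊖ʳ f g h zero    = base (f 0) (g 0) (h 0)
  where
  base : ∀ a b c → a ℤ.* (b ℤ.- c) ≡ a ℤ.* b ℤ.- a ℤ.* c
  base = ℤ-Solver.solve-∀
conv-⊖ʳ f g h (suc n) =
  trans (cong (ℤ._+_ (f 0 ℤ.* (g (suc n) ℤ.- h (suc n)))) (conv-⊖ʳ (f ∘ suc) g h n))
        (lemma (f 0) (g (suc n)) (h (suc n)) (conv (f ∘ suc) g n) (conv (f ∘ suc) h n))
  where
  lemma : ∀ a b c x y →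
          a ℤ.* (b ℤ.- c) ℤ.+ (x ℤ.- y) ≡ (a ℤ.* b ℤ.+ x) ℤ.- (a ℤ.* c ℤ.+ y)
  lemma = ℤ-Solver.solve-∀

conv-⊕ʳ : ∀ f g h → conv f (g ⊕ h) ≗ conv f g ⊕ conv f h
conv-⊕ʳ f g h zero    = ℤₚ.*-distribˡ-+ (f 0) (g 0) (h 0)
conv-⊕ʳ f g h (suc n) =
  trans (cong (ℤ._+_ (f 0 ℤ.* (g (suc n) ℤ.+ h (suc n)))) (conv-⊕ʳ (f ∘ suc) g h n))
        (lemma (f 0) (g (suc n)) (h (suc n)) (conv (f ∘ suc) g n) (conv (f ∘ suc) h n))
  where
  lemma : ∀ a b c x y →
          a ℤ.* (b ℤ.+ c) ℤ.+ (x ℤ.+ y) ≡ (a ℤ.* b ℤ.+ x) ℤ.+ (a ℤ.* c ℤ.+ y)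
  lemma = ℤ-Solver.solve-∀

shift : Series → Series
shift f zero    = + 0
shift f (suc n) = f n

scale : ℤ → Series → Series
scale c f n = c ℤ.* f n

conv-shiftʳ : ∀ f g → conv f (shift g) ≗ shift (conv f g)
conv-shiftʳ f g zero          = ℤₚ.*-zeroʳ (f 0)
conv-shiftʳ f g (suc zero)    =
  trans (cong (ℤ._+_ (f 0 ℤ.* g 0)) (ℤₚ.*-zeroʳ (f 1))) (ℤₚ.+-identityʳ _)
conv-shiftʳ f g (suc (suc n)) = cong (ℤ._+_ (f 0 ℤ.* g (suc n))) (conv-shiftʳ (f ∘ suc) g (suc n))

conv-scaleʳ : ∀ c f g → conv f (scale c g) ≗ scale c (conv f g)
conv-scaleʳ c f g zero    = lemma c (f 0) (g 0)
  where
  lemma : ∀ c x y → x ℤ.* (c ℤ.* y) ≡ c ℤ.* (x ℤ.* y)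
  lemma = ℤ-Solver.solve-∀
conv-scaleʳ c f g (suc n) =
  trans (cong (ℤ._+_ (f 0 ℤ.* (c ℤ.* g (suc n)))) (conv-scaleʳ c (f ∘ suc) g n))
        (lemma c (f 0) (g (suc n)) (conv (f ∘ suc) g n))
  where
  lemma : ∀ c x y z → x ℤ.* (c ℤ.* y) ℤ.+ c ℤ.* z ≡ c ℤ.* (x ℤ.* y ℤ.+ z)
  lemma = ℤ-Solver.solve-∀

conv-zeroˡ : ∀ g → conv (λ _ → + 0) g ≗ λ _ → + 0
conv-zeroˡ g zero    = refl
conv-zeroˡ g (suc n) = trans (ℤₚ.+-identityˡ _) (conv-zeroˡ g n)

conv-const : ∀ c g → conv (const c) g ≗ scale c g
conv-const c g zero    = refl
conv-const c g (suc n) =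
  trans (cong (ℤ._+_ (c ℤ.* g (suc n))) (conv-zeroˡ g n)) (ℤₚ.+-identityʳ _)

conv-oneʳ : ∀ f → conv f (const (+ 1)) ≗ f
conv-oneʳ f zero    = ℤₚ.*-identityʳ (f 0)
conv-oneʳ f (suc n) =
  trans (cong₂ ℤ._+_ (ℤₚ.*-zeroʳ (f 0)) (conv-oneʳ (f ∘ suc) n)) (ℤₚ.+-identityˡ _)

conv-X : ∀ g → conv X g ≗ shift g
conv-X g zero    = refl
conv-X g (suc n) =
  trans (ℤₚ.+-identityˡ _)
        (trans (conv-cong X∘suc≗1 (λ _ → refl) n)
               (trans (conv-const (+ 1) g n) (ℤₚ.*-identityˡ (g n))))
  where
  X∘suc≗1 : X ∘ suc ≗ const (+ 1)
  X∘suc≗1 zero    = refl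
  X∘suc≗1 (suc _) = refl

conv-shiftˡ : ∀ f g → conv (shift f) g ≗ shift (conv f g)
conv-shiftˡ f g zero    = refl
conv-shiftˡ f g (suc n) = ℤₚ.+-identityˡ _

conv-⊖ˡ : ∀ f g h → conv (f ⊖ g) h ≗ conv f h ⊖ conv g h
conv-⊖ˡ f g h zero    = base (h 0) (f 0) (g 0)
  where
  base : ∀ c a b → (a ℤ.- b) ℤ.* c ≡ a ℤ.* c ℤ.- b ℤ.* c
  base = ℤ-Solver.solve-∀
conv-⊖ˡ f g h (suc n) =
  trans (cong (ℤ._+_ ((f 0 ℤ.- g 0) ℤ.* h (suc n))) (conv-⊖ˡ (f ∘ suc) (g ∘ suc) h n))
        (lemma (f 0) (g 0) (h (suc n)) (conv (f ∘ suc) h n) (conv (g ∘ suc) h n))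
  where
  lemma : ∀ a b c x y →
          (a ℤ.- b) ℤ.* c ℤ.+ (x ℤ.- y) ≡ (a ℤ.* c ℤ.+ x) ℤ.- (b ℤ.* c ℤ.+ y)
  lemma = ℤ-Solver.solve-∀

-- Ballot numbers and the closed form of the Catalan numbers.

-- ballot d m is the coefficient of xᵈ in C(x)ᵐ.
ballot : ℕ → ℕ → ℕ
ballot zero    m       = 1
ballot (suc d) zero    = 0
ballot (suc d) (suc m) = ballot (suc d) m ℕ.+ ballot d (suc (suc m))

-- The reflection formula for ballot numbers, a difference of two neighbouring binomial
-- coefficients, written additively to stay in `ℕ`. Pascal's rule carries the recurrence of `ballot`
-- through the induction.
ballot-binomial : ∀ d m →
  ballot (suc d) (suc m) ℕ.+ (suc d ℕ.+ suc d ℕ.+ m) C d ≡ (suc d ℕ.+ suc d ℕ.+ m) C (suc d)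
ballot-binomial zero zero    = refl
ballot-binomial zero (suc m) = begin
  ballot 1 (suc m) ℕ.+ 1 ℕ.+ (3 ℕ.+ m) C 0   ≡⟨ cong (ℕ._+ 1) (ℕₚ.+-comm (ballot 1 (suc m)) 1) ⟩
  1 ℕ.+ (ballot 1 (suc m) ℕ.+ (2 ℕ.+ m) C 0) ≡⟨ cong (1 ℕ.+_) (ballot-binomial zero m) ⟩
  (2 ℕ.+ m) C 0 ℕ.+ (2 ℕ.+ m) C 1            ≡⟨ nCk+nC[k+1]≡[n+1]C[k+1] (2 ℕ.+ m) 0 ⟩
  (3 ℕ.+ m) C 1                              ∎
  where open ≡-Reasoning
ballot-binomial (suc d) zero = begin
  ballot (suc d) 2 ℕ.+ (N ℕ.+ 0) C suc d
    ≡⟨ cong (λ x → ballot (suc d) 2 ℕ.+ x C suc d) N+0 ⟩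
  ballot (suc d) 2 ℕ.+ suc M C suc d
    ≡⟨ cong (ballot (suc d) 2 ℕ.+_) (sym (nCk+nC[k+1]≡[n+1]C[k+1] M d)) ⟩
  ballot (suc d) 2 ℕ.+ (M C d ℕ.+ M C suc d)
    ≡⟨ sym (ℕₚ.+-assoc (ballot (suc d) 2) (M C d) (M C suc d)) ⟩
  ballot (suc d) 2 ℕ.+ M C d ℕ.+ M C suc d
    -- The summand `ballot (suc (suc d)) 0` has vanished. In place of an induction hypothesis for it
    -- there is the symmetry of row `M = 2d + 3` about its middle.
    ≡⟨ cong₂ ℕ._+_ (ballot-binomial d 1) M-sym ⟩
  M C suc d ℕ.+ M C suc (suc d)
    ≡⟨ nCk+nC[k+1]≡[n+1]C[k+1] M (suc d) ⟩
  suc M C suc (suc d)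
    ≡⟨ cong (_C suc (suc d)) (sym N+0) ⟩
  (N ℕ.+ 0) C suc (suc d) ∎
  where
  open ≡-Reasoning
  N = suc (suc d) ℕ.+ suc (suc d)
  M = suc d ℕ.+ suc d ℕ.+ 1
  N+0 : N ℕ.+ 0 ≡ suc M
  N+0 = lemma d
    where
    lemma : ∀ d → suc (suc d) ℕ.+ suc (suc d) ℕ.+ 0 ≡ suc (suc d ℕ.+ suc d ℕ.+ 1)
    lemma = ℕ-Solver.solve-∀
  M≡ : M ≡ suc d ℕ.+ suc (suc d)
  M≡ = lemma d
    where
    lemma : ∀ d → suc d ℕ.+ suc d ℕ.+ 1 ≡ suc d ℕ.+ suc (suc d)
    lemma = ℕ-Solver.solve-∀
  M-sym : M C suc d ≡ M C suc (suc d)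
  M-sym = trans (nCk≡nC[n∸k] (subst (suc d ≤_) (sym M≡) (ℕₚ.m≤m+n (suc d) _)))
                (cong (M C_) (trans (cong (_∸ suc d) M≡) (ℕₚ.m+n∸m≡n (suc d) _)))
ballot-binomial (suc d) (suc m) = begin
  (ballot (suc (suc d)) (suc m) ℕ.+ ballot (suc d) (suc (suc (suc m)))) ℕ.+ (N ℕ.+ suc m) C suc d
    ≡⟨ cong (λ x → b₁ ℕ.+ b₂ ℕ.+ x C suc d) (ℕₚ.+-suc N m) ⟩
  b₁ ℕ.+ b₂ ℕ.+ suc (N ℕ.+ m) C suc d
    ≡⟨ cong (b₁ ℕ.+ b₂ ℕ.+_) (sym (nCk+nC[k+1]≡[n+1]C[k+1] (N ℕ.+ m) d)) ⟩
  b₁ ℕ.+ b₂ ℕ.+ ((N ℕ.+ m) C d ℕ.+ (N ℕ.+ m) C suc d)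
    ≡⟨ lemma b₁ b₂ _ _ ⟩
  (b₂ ℕ.+ (N ℕ.+ m) C d) ℕ.+ (b₁ ℕ.+ (N ℕ.+ m) C suc d)
    -- Both terms of the recurrence have formulas with the same upper index `N + m`, so Pascal's
    -- rule recombines them.
    ≡⟨ cong₂ ℕ._+_ IH (ballot-binomial (suc d) m) ⟩
  (N ℕ.+ m) C suc d ℕ.+ (N ℕ.+ m) C suc (suc d)
    ≡⟨ nCk+nC[k+1]≡[n+1]C[k+1] (N ℕ.+ m) (suc d) ⟩
  suc (N ℕ.+ m) C suc (suc d)
    ≡⟨ cong (_C suc (suc d)) (sym (ℕₚ.+-suc N m)) ⟩
  (N ℕ.+ suc m) C suc (suc d) ∎
  where
  open ≡-Reasoning
  N = suc (suc d) ℕ.+ suc (suc d)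
  b₁ = ballot (suc (suc d)) (suc m)
  b₂ = ballot (suc d) (suc (suc (suc m)))
  lemma : ∀ a b c e → a ℕ.+ b ℕ.+ (c ℕ.+ e) ≡ (b ℕ.+ c) ℕ.+ (a ℕ.+ e)
  lemma = ℕ-Solver.solve-∀
  N+m : suc d ℕ.+ suc d ℕ.+ suc (suc m) ≡ N ℕ.+ m
  N+m = lemma′ d m
    where
    lemma′ : ∀ d m → suc d ℕ.+ suc d ℕ.+ suc (suc m) ≡ suc (suc d) ℕ.+ suc (suc d) ℕ.+ m
    lemma′ = ℕ-Solver.solve-∀
  IH : b₂ ℕ.+ (N ℕ.+ m) C d ≡ (N ℕ.+ m) C suc d
  IH = subst (λ x → b₂ ℕ.+ x C d ≡ x C suc d) N+m (ballot-binomial d (suc (suc m)))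

[k+1]*[n+1]C[k+1]≡[n+1]*nCk : ∀ n k → suc k ℕ.* (suc n C suc k) ≡ suc n ℕ.* (n C k)
[k+1]*[n+1]C[k+1]≡[n+1]*nCk zero    zero    = refl
[k+1]*[n+1]C[k+1]≡[n+1]*nCk zero    (suc k) = ℕₚ.*-zeroʳ (suc (suc k))
[k+1]*[n+1]C[k+1]≡[n+1]*nCk (suc n) zero    = begin
  1 ℕ.* (suc (suc n) C 1)       ≡⟨ ℕₚ.*-identityˡ _ ⟩
  suc (suc n) C 1             ≡⟨ nC1≡n (suc (suc n)) ⟩
  suc (suc n)                 ≡⟨ sym (ℕₚ.*-identityʳ _) ⟩
  suc (suc n) ℕ.* (suc n C 0)   ∎
  where open ≡-Reasoning
[k+1]*[n+1]C[k+1]≡[n+1]*nCk (suc n) (suc k) = begin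
  suc (suc k) ℕ.* (suc (suc n) C suc (suc k))
    ≡⟨ cong (suc (suc k) ℕ.*_) (sym (nCk+nC[k+1]≡[n+1]C[k+1] (suc n) (suc k))) ⟩
  suc (suc k) ℕ.* (suc n C suc k ℕ.+ suc n C suc (suc k))
    ≡⟨ expand k (suc n C suc k) (suc n C suc (suc k)) ⟩
  suc k ℕ.* (suc n C suc k) ℕ.+ suc (suc k) ℕ.* (suc n C suc (suc k)) ℕ.+ suc n C suc k
    ≡⟨ cong₂ (λ x y → x ℕ.+ y ℕ.+ suc n C suc k) ([k+1]*[n+1]C[k+1]≡[n+1]*nCk n k)
                                                  ([k+1]*[n+1]C[k+1]≡[n+1]*nCk n (suc k)) ⟩
  suc n ℕ.* (n C k) ℕ.+ suc n ℕ.* (n C suc k) ℕ.+ suc n C suc k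
    ≡⟨ cong (ℕ._+ suc n C suc k) (sym (ℕₚ.*-distribˡ-+ (suc n) (n C k) (n C suc k))) ⟩
  suc n ℕ.* (n C k ℕ.+ n C suc k) ℕ.+ suc n C suc k
    ≡⟨ cong (λ x → suc n ℕ.* x ℕ.+ suc n C suc k) (nCk+nC[k+1]≡[n+1]C[k+1] n k) ⟩
  suc n ℕ.* (suc n C suc k) ℕ.+ suc n C suc k
    ≡⟨ ℕₚ.+-comm _ (suc n C suc k) ⟩
  suc (suc n) ℕ.* (suc n C suc k) ∎
  where
  open ≡-Reasoning
  expand : ∀ k x y → suc (suc k) ℕ.* (x ℕ.+ y) ≡ suc k ℕ.* x ℕ.+ suc (suc k) ℕ.* y ℕ.+ x
  expand = ℕ-Solver.solve-∀

nCk-sym : ∀ j k → (j ℕ.+ k) C j ≡ (j ℕ.+ k) C k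
nCk-sym j k = trans (nCk≡nC[n∸k] (ℕₚ.m≤m+n j k)) (cong ((j ℕ.+ k) C_) (ℕₚ.m+n∸m≡n j k))

-- For n ≥ 1 the reflection formula makes `ballot n 1` the difference of `2n C n` and `2n C (n-1)`,
-- and (n+1) times the latter is n times the former. The term to be subtracted is added to both
-- sides and cancelled.
[n+1]*ballot≡2nCn : ∀ n → suc n ℕ.* ballot n 1 ≡ (2 ℕ.* n) C n
[n+1]*ballot≡2nCn zero    = refl
[n+1]*ballot≡2nCn (suc d) = ℕₚ.+-cancelʳ-≡ (suc (suc d) ℕ.* (N C d)) _ _ (begin
  suc (suc d) ℕ.* ballot (suc d) 1 ℕ.+ suc (suc d) ℕ.* (N C d)
    ≡⟨ sym (ℕₚ.*-distribˡ-+ (suc (suc d)) (ballot (suc d) 1) _) ⟩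
  suc (suc d) ℕ.* (ballot (suc d) 1 ℕ.+ N C d)
    ≡⟨ cong (suc (suc d) ℕ.*_) ballot-N ⟩
  N C suc d ℕ.+ suc d ℕ.* (N C suc d)
    ≡⟨ cong (N C suc d ℕ.+_) (sym absorb) ⟩
  N C suc d ℕ.+ suc (suc d) ℕ.* (N C d) ∎)
  where
  open ≡-Reasoning
  N = 2 ℕ.* suc d
  M = d ℕ.+ suc d
  N≡1+M : N ≡ suc M
  N≡1+M = lemma d
    where
    lemma : ∀ d → 2 ℕ.* suc d ≡ suc (d ℕ.+ suc d)
    lemma = ℕ-Solver.solve-∀
  N≡ : suc d ℕ.+ suc d ℕ.+ 0 ≡ N
  N≡ = lemma d
    where
    lemma : ∀ d → suc d ℕ.+ suc d ℕ.+ 0 ≡ 2 ℕ.* suc d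
    lemma = ℕ-Solver.solve-∀
  N≡d+[2+d] : N ≡ d ℕ.+ suc (suc d)
  N≡d+[2+d] = lemma d
    where
    lemma : ∀ d → 2 ℕ.* suc d ≡ d ℕ.+ suc (suc d)
    lemma = ℕ-Solver.solve-∀
  ballot-N : ballot (suc d) 1 ℕ.+ N C d ≡ N C suc d
  ballot-N = subst (λ x → ballot (suc d) 1 ℕ.+ x C d ≡ x C suc d) N≡ (ballot-binomial d 0)
  -- Both sides absorb to `suc M` times a binomial coefficient from the middle of row `M = 2d + 1`,
  -- after a reflection of row `N` on the left.
  absorb : suc (suc d) ℕ.* (N C d) ≡ suc d ℕ.* (N C suc d)
  absorb = begin
    suc (suc d) ℕ.* (N C d)
      ≡⟨ cong (suc (suc d) ℕ.*_)
           (subst (λ x → x C d ≡ x C suc (suc d)) (sym N≡d+[2+d]) (nCk-sym d (suc (suc d)))) ⟩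
    suc (suc d) ℕ.* (N C suc (suc d))      ≡⟨ cong (λ x → suc (suc d) ℕ.* (x C suc (suc d))) N≡1+M ⟩
    suc (suc d) ℕ.* (suc M C suc (suc d))  ≡⟨ [k+1]*[n+1]C[k+1]≡[n+1]*nCk M (suc d) ⟩
    suc M ℕ.* (M C suc d)                  ≡⟨ cong (suc M ℕ.*_) (sym (nCk-sym d (suc d))) ⟩
    suc M ℕ.* (M C d)                      ≡⟨ sym ([k+1]*[n+1]C[k+1]≡[n+1]*nCk M d) ⟩
    suc d ℕ.* (suc M C suc d)              ≡⟨ cong (λ x → suc d ℕ.* (x C suc d)) (sym N≡1+M) ⟩
    suc d ℕ.* (N C suc d)                  ∎

ballot-catalan : ∀ n → ballot n 1 ≡ catalan n
ballot-catalan n = begin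
  ballot n 1                        ≡⟨ sym (m*n/n≡m (ballot n 1) (suc n)) ⟩
  (ballot n 1 ℕ.* suc n) / suc n    ≡⟨ /-congˡ {o = suc n} (trans (ℕₚ.*-comm (ballot n 1) (suc n))
                                                                    ([n+1]*ballot≡2nCn n)) ⟩
  ((2 ℕ.* n) C n) / suc n           ∎
  where open ≡-Reasoning

-- Families of series in which raising the index multiplies by C(x).

-- T (m + 1) = T m + x T (m + 2), which forces T m = C(x)ᵐ T 0.
record BallotFamily (T : ℕ → Series) : Set where
  field
    head≡ : ∀ m → T (suc m) 0 ≡ T m 0
    tail≡ : ∀ m d → T (suc m) (suc d) ≡ T m (suc d) ℤ.+ T (suc (suc m)) d

open BallotFamily

column : (ℕ → ℕ → ℕ) → ℕ → Series
column t m = ofℕ (λ d → t d m)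

ballot-family : BallotFamily (column ballot)
ballot-family .head≡ m   = refl
ballot-family .tail≡ m d = refl

family-step : ∀ {T} → BallotFamily T → ∀ m → T (suc m) ≗ T m ⊕ shift (T (suc (suc m)))
family-step fam m zero    = trans (fam .head≡ m) (sym (ℤₚ.+-identityʳ _))
family-step fam m (suc d) = fam .tail≡ m d

ballot-zero : column ballot 0 ≗ const (+ 1)
ballot-zero zero    = refl
ballot-zero (suc n) = refl

-- Expanding `column ballot (suc k)` by its recurrence reproduces the recurrence of `T`. As in the
-- definition of `ballot`, the induction either lowers `k` at the same coefficient `d`, or lowers
-- `d` while `k` grows.
conv-ballot : ∀ {T} → BallotFamily T → ∀ m k d → conv (T m) (column ballot k) d ≡ T (m ℕ.+ k) d
conv-ballot {T} fam m zero d = begin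
  conv (T m) (column ballot 0) d   ≡⟨ conv-cong (λ _ → refl) ballot-zero d ⟩
  conv (T m) (const (+ 1)) d       ≡⟨ conv-oneʳ (T m) d ⟩
  T m d                            ≡⟨ cong (λ x → T x d) (sym (ℕₚ.+-identityʳ m)) ⟩
  T (m ℕ.+ 0) d                    ∎
  where open ≡-Reasoning
conv-ballot {T} fam m (suc k) d = begin
  conv (T m) (column ballot (suc k)) d
    ≡⟨ conv-cong {f = T m} (λ _ → refl) (family-step ballot-family k) d ⟩
  conv (T m) (column ballot k ⊕ shift (column ballot (2 ℕ.+ k))) d
    ≡⟨ conv-⊕ʳ (T m) _ _ d ⟩
  conv (T m) (column ballot k) d ℤ.+ conv (T m) (shift (column ballot (2 ℕ.+ k))) d
    ≡⟨ cong₂ ℤ._+_ (conv-ballot fam m k d)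
                    (trans (conv-shiftʳ (T m) _ d) (shifted d)) ⟩
  (T (m ℕ.+ k) ⊕ shift (T (suc (suc (m ℕ.+ k))))) d
    ≡⟨ sym (family-step fam (m ℕ.+ k) d) ⟩
  T (suc (m ℕ.+ k)) d
    ≡⟨ cong (λ x → T x d) (sym (ℕₚ.+-suc m k)) ⟩
  T (m ℕ.+ suc k) d ∎
  where
  open ≡-Reasoning
  shifted : ∀ d → shift (conv (T m) (column ballot (2 ℕ.+ k))) d ≡ shift (T (suc (suc (m ℕ.+ k)))) d
  shifted zero    = refl
  shifted (suc d) =
    trans (conv-ballot fam m (suc (suc k)) d)
          (cong (λ x → T x d) (trans (ℕₚ.+-suc m (suc k)) (cong suc (ℕₚ.+-suc m k))))

conv-scaleˡ : ∀ c f g → conv (scale c f) g ≗ scale c (conv f g)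
conv-scaleˡ c f g zero    = ℤₚ.*-assoc c (f 0) (g 0)
conv-scaleˡ c f g (suc n) =
  trans (cong₂ ℤ._+_ (ℤₚ.*-assoc c (f 0) (g (suc n))) (conv-scaleˡ c (f ∘ suc) g n))
        (sym (ℤₚ.*-distribˡ-+ c (f 0 ℤ.* g (suc n)) (conv (f ∘ suc) g n)))

shift-cong : ∀ {f g} → f ≗ g → shift f ≗ shift g
shift-cong p zero    = refl
shift-cong p (suc n) = p n

⊖-cong : ∀ {f f′ g g′} → f ≗ f′ → g ≗ g′ → f ⊖ g ≗ f′ ⊖ g′
⊖-cong p q n = cong₂ ℤ._-_ (p n) (q n)

scale-cong : ∀ c {f g} → f ≗ g → scale c f ≗ scale c g
scale-cong c p n = cong (c ℤ.*_) (p n)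

≗-trans : ∀ {f g h : Series} → f ≗ g → g ≗ h → f ≗ h
≗-trans p q n = trans (p n) (q n)

-- Recurrences for the counts and the functional equation.

-- count d m is h (d + m) m, so that its columns are the series C(x)ᵐ F(x);
-- asc counts the avoiders with an ascent below the first entry, and asc′
-- those among them which do not start with their maximum.
mutual
  count : ℕ → ℕ → ℕ
  count zero    m       = 1
  count (suc d) zero    = count d 1 ℕ.+ asc (suc d)
  count (suc d) (suc m) = count (suc d) m ℕ.+ count d (suc (suc m))

  asc : ℕ → ℕ
  asc zero    = 0
  asc (suc n) = (count n 0 ∸ 1) ℕ.+ asc′ (suc n)

  asc′ : ℕ → ℕ
  asc′ zero    = 0
  asc′ (suc n) = asc n ℕ.+ asc′ n

-- Ensures that the truncated subtraction in `asc` is exact.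
1≤count : ∀ d m → 1 ≤ count d m
1≤count zero    m       = ℕₚ.≤-refl
1≤count (suc d) zero    = ℕₚ.≤-trans (1≤count d 1) (ℕₚ.m≤m+n _ _)
1≤count (suc d) (suc m) = ℕₚ.≤-trans (1≤count (suc d) m) (ℕₚ.m≤m+n _ _)

-- Eliminates `asc′`: unfolding `asc (suc (suc n))` leaves one `asc′ (suc n)`, which the definition
-- of `asc (suc n)` expresses through `asc` and `count`.
asc-rec : ∀ n → asc (suc (suc n)) ℕ.+ count n 0 ≡ asc (suc n) ℕ.+ asc (suc n) ℕ.+ count (suc n) 0
asc-rec n = begin
  (x ∸ 1) ℕ.+ (asc (suc n) ℕ.+ asc′ (suc n)) ℕ.+ y
    ≡⟨ cong (λ z → (x ∸ 1) ℕ.+ (asc (suc n) ℕ.+ asc′ (suc n)) ℕ.+ z) (sym (ℕₚ.m∸n+n≡m (1≤count n 0))) ⟩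
  (x ∸ 1) ℕ.+ (asc (suc n) ℕ.+ asc′ (suc n)) ℕ.+ ((y ∸ 1) ℕ.+ 1)
    ≡⟨ lemma (x ∸ 1) (asc (suc n)) (asc′ (suc n)) (y ∸ 1) ⟩
  asc (suc n) ℕ.+ ((y ∸ 1) ℕ.+ asc′ (suc n)) ℕ.+ ((x ∸ 1) ℕ.+ 1)
    ≡⟨ cong (λ z → asc (suc n) ℕ.+ asc (suc n) ℕ.+ z) (ℕₚ.m∸n+n≡m (1≤count (suc n) 0)) ⟩
  asc (suc n) ℕ.+ asc (suc n) ℕ.+ x ∎
  where
  open ≡-Reasoning
  x = count (suc n) 0
  y = count n 0
  lemma : ∀ x c d y → x ℕ.+ (c ℕ.+ d) ℕ.+ (y ℕ.+ 1) ≡ c ℕ.+ (y ℕ.+ d) ℕ.+ (x ℕ.+ 1)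
  lemma = ℕ-Solver.solve-∀

count-family : BallotFamily (column count)
count-family .head≡ m   = refl
count-family .tail≡ m d = refl

module _ where
  private
    -- As power series, `A` is F, `B` is CF, `P` is C, `G` is F - xCF and `numerator` is 1 - 3x.
    A B P G numerator : Series
    A = column count 0
    B = column count 1
    P = column ballot 1
    G = A ⊖ shift B
    numerator = const (+ 1) ⊖ scale (+ 3) (shift (const (+ 1)))

  G-suc : ∀ n → G (suc n) ≡ + asc (suc n)
  G-suc n = lemma (+ count n 1) (+ asc (suc n))
    where
    lemma : ∀ x y → x ℤ.+ y ℤ.- x ≡ y
    lemma = ℤ-Solver.solve-∀

  -- Beyond the constant term the coefficients of `G` are the values of `asc`, so from x² on this is
  -- `asc-rec`; the two lowest coefficients, 1 and -3, are computed.
  functional-equation : (G ⊖ scale (+ 2) (shift G)) ⊖ shift (A ⊖ shift A) ≗ numerator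
  functional-equation zero          = refl
  functional-equation (suc zero)    = refl
  functional-equation (suc (suc n)) = begin
    G (suc (suc n)) ℤ.- + 2 ℤ.* G (suc n) ℤ.- (A (suc n) ℤ.- A n)
      ≡⟨ cong₂ (λ x y → x ℤ.- + 2 ℤ.* y ℤ.- (A (suc n) ℤ.- A n)) (G-suc (suc n)) (G-suc n) ⟩
    + asc (suc (suc n)) ℤ.- + 2 ℤ.* + asc (suc n) ℤ.- (A (suc n) ℤ.- A n)
      ≡⟨ regroup (+ asc (suc (suc n))) (+ asc (suc n)) (A (suc n)) (A n) ⟩
    + (asc (suc (suc n)) ℕ.+ count n 0) ℤ.- + (asc (suc n) ℕ.+ asc (suc n) ℕ.+ count (suc n) 0)
      ≡⟨ ℤₚ.i≡j⇒i-j≡0 (cong +_ (asc-rec n)) ⟩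
    + 0 ∎
    where
    open ≡-Reasoning
    regroup : ∀ x y u v → x ℤ.- + 2 ℤ.* y ℤ.- (u ℤ.- v) ≡ (x ℤ.+ v) ℤ.- (y ℤ.+ y ℤ.+ u)
    regroup = ℤ-Solver.solve-∀

  -- This is C = 1 + xC² multiplied by F, in the form C(F - xCF) = F. It comes from the family
  -- recurrence at index 0, where the two copies of xC²F cancel.
  conv-G : conv G P ≗ A
  conv-G n = begin
    conv G P n                              ≡⟨ conv-⊖ˡ A (shift B) P n ⟩
    conv A P n ℤ.- conv (shift B) P n       ≡⟨ cong₂ ℤ._-_ (conv-ballot count-family 0 1 n) shifted ⟩
    B n ℤ.- shift (column count 2) n
      ≡⟨ cong (ℤ._- shift (column count 2) n) (family-step count-family 0 n) ⟩
    A n ℤ.+ shift (column count 2) n ℤ.- shift (column count 2) n ≡⟨ lemma (A n) (shift (column count 2) n) ⟩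
    A n ∎
    where
    open ≡-Reasoning
    shifted : conv (shift B) P n ≡ shift (column count 2) n
    shifted = trans (conv-shiftˡ B P n) (shift-cong (conv-ballot count-family 1 1) n)
    lemma : ∀ x y → x ℤ.+ y ℤ.- y ≡ x
    lemma = ℤ-Solver.solve-∀

  Cat≗P : Cat ≗ P
  Cat≗P n = cong +_ (sym (ballot-catalan n))

  conv-AP : conv A P ≗ B
  conv-AP = conv-ballot count-family 0 1

  const-⊛-X : ∀ c → const c ⊛ X ≗ scale c (shift (const (+ 1)))
  const-⊛-X c = ≗-trans (⊛≗conv (const c) X) (≗-trans (conv-const c X) (scale-cong c X≗))
    where
    X≗ : X ≗ shift (const (+ 1))
    X≗ zero          = refl
    X≗ (suc zero)    = refl
    X≗ (suc (suc _)) = refl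

  numerator-⊛ : (const (+ 1) ⊖ (const (+ 3) ⊛ X)) ⊛ Cat ≗ conv numerator P
  numerator-⊛ = ≗-trans (⊛≗conv _ Cat) (conv-cong (⊖-cong {f = const (+ 1)} (λ _ → refl) (const-⊛-X (+ 3))) Cat≗P)

  X[1-X]-⊛ : (X ⊛ (const (+ 1) ⊖ X)) ⊛ Cat ≗ shift (P ⊖ shift P)
  X[1-X]-⊛ =
    ≗-trans (⊛≗conv _ Cat)
    (≗-trans (conv-cong (≗-trans (⊛≗conv X _) (conv-X (const (+ 1) ⊖ X))) Cat≗P)
    (≗-trans (conv-shiftˡ (const (+ 1) ⊖ X) P)
    (shift-cong (≗-trans (conv-⊖ˡ (const (+ 1)) X P)
                         (⊖-cong (≗-trans (conv-const (+ 1) P) (λ n → ℤₚ.*-identityˡ (P n)))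
                                 (conv-X P))))))

  denominator-⊛ :
    A ⊛ ((const (+ 1) ⊖ (const (+ 2) ⊛ X)) ⊖ ((X ⊛ (const (+ 1) ⊖ X)) ⊛ Cat))
    ≗ (A ⊖ scale (+ 2) (shift A)) ⊖ shift (B ⊖ shift B)
  denominator-⊛ =
    ≗-trans (⊛≗conv A _)
    (≗-trans (conv-cong {f = A} (λ _ → refl)
                        (⊖-cong (⊖-cong {f = const (+ 1)} (λ _ → refl) (const-⊛-X (+ 2))) X[1-X]-⊛))
    (≗-trans (conv-⊖ʳ A _ _)
    (⊖-cong (≗-trans (conv-⊖ʳ A _ _)
                     (⊖-cong (conv-oneʳ A)
                             (≗-trans (conv-scaleʳ (+ 2) A _)
                                      (scale-cong (+ 2) (≗-trans (conv-shiftʳ A _) (shift-cong (conv-oneʳ A)))))))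
            (≗-trans (conv-shiftʳ A _)
                     (shift-cong (≗-trans (conv-⊖ʳ A P _)
                                          (⊖-cong conv-AP (≗-trans (conv-shiftʳ A P) (shift-cong conv-AP)))))))))

  -- Multiplying the functional equation by C turns `G` into `A` and `A` into `B`.
  functional-equation-⊛ : (A ⊖ scale (+ 2) (shift A)) ⊖ shift (B ⊖ shift B) ≗ conv numerator P
  functional-equation-⊛ n = sym (begin
    conv numerator P n
      ≡⟨ conv-cong (λ m → sym (functional-equation m)) (λ _ → refl) n ⟩
    conv ((G ⊖ scale (+ 2) (shift G)) ⊖ shift (A ⊖ shift A)) P n
      ≡⟨ ≗-trans (conv-⊖ˡ _ _ P) (⊖-cong left right) n ⟩
    ((A ⊖ scale (+ 2) (shift A)) ⊖ shift (B ⊖ shift B)) n ∎)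
    where
    open ≡-Reasoning
    left : conv (G ⊖ scale (+ 2) (shift G)) P ≗ A ⊖ scale (+ 2) (shift A)
    left = ≗-trans (conv-⊖ˡ G _ P)
      (⊖-cong conv-G (≗-trans (conv-scaleˡ (+ 2) (shift G) P)
                              (scale-cong (+ 2) (≗-trans (conv-shiftˡ G P) (shift-cong conv-G)))))
    right : conv (shift (A ⊖ shift A)) P ≗ shift (B ⊖ shift B)
    right = ≗-trans (conv-shiftˡ (A ⊖ shift A) P)
      (shift-cong (≗-trans (conv-⊖ˡ A (shift A) P)
                           (⊖-cong conv-AP (≗-trans (conv-shiftˡ A P) (shift-cong conv-AP)))))

  generating-function :
    A ⊛ ((const (+ 1) ⊖ (const (+ 2) ⊛ X)) ⊖ ((X ⊛ (const (+ 1) ⊖ X)) ⊛ Cat))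
    ≗ (const (+ 1) ⊖ (const (+ 3) ⊛ X)) ⊛ Cat
  generating-function n =
    trans (denominator-⊛ n) (trans (functional-equation-⊛ n) (sym (numerator-⊛ n)))

-- Counting the lists that satisfy a predicate.

module _ {A : Set} where

  unique-⊆⇒length≤ : ∀ {xs ys : List A} → Unique xs → (∀ {x} → x ∈ xs → x ∈ ys) →
                     length xs ≤ length ys
  unique-⊆⇒length≤ [] _ = z≤n
  unique-⊆⇒length≤ {x ∷ xs} (x∉ ∷ uniq) sub with ∈-∃++ (sub (here refl))
  ... | us , vs , refl = begin
    suc (length xs)            ≤⟨ s≤s (unique-⊆⇒length≤ uniq sub′) ⟩
    suc (length (us ++ vs))    ≡⟨ cong suc (Listₚ.length-++ us) ⟩
    suc (length us + length vs) ≡⟨ sym (ℕₚ.+-suc (length us) (length vs)) ⟩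
    length us + suc (length vs) ≡⟨ sym (Listₚ.length-++ us) ⟩
    length (us ++ x ∷ vs)      ∎
    where
    open ℕₚ.≤-Reasoning
    sub′ : ∀ {y} → y ∈ xs → y ∈ us ++ vs
    sub′ y∈ with ∈-++⁻ us (sub (there y∈))
    ... | inj₁ y∈us          = ∈-++⁺ˡ y∈us
    ... | inj₂ (here refl)   = contradiction refl (All.lookup x∉ y∈)
    ... | inj₂ (there y∈vs)  = ∈-++⁺ʳ us y∈vs

  unique-map : ∀ {B : Set} {f : A → B} {xs} → Unique xs →
               (∀ {x y} → x ∈ xs → y ∈ xs → f x ≡ f y → x ≡ y) → Unique (map f xs)
  unique-map [] _ = []
  unique-map {f = f} {x ∷ xs} (x∉ ∷ uniq) inj =
    All.tabulate (λ z∈ fx≡z → let y , y∈ , z≡fy = ∈-map⁻ f z∈ in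
      All.lookup x∉ y∈ (inj (here refl) (there y∈) (trans fx≡z z≡fy)))
    ∷ unique-map uniq (λ p q → inj (there p) (there q))

Pred : Set₁
Pred = List ℕ → Set

Card : Pred → ℕ → Set
Card P k = Σ (List (List ℕ)) λ L → Unique L × (∀ σ → (σ ∈ L) ⇔ P σ) × (length L ≡ k)

card-unique : ∀ {P k l} → Card P k → Card P l → k ≡ l
card-unique (L , uL , eL , refl) (M , uM , eM , refl) = ℕₚ.≤-antisym
  (unique-⊆⇒length≤ uL (λ p → from (eM _) (to (eL _) p)))
  (unique-⊆⇒length≤ uM (λ p → from (eL _) (to (eM _) p)))

card-map : ∀ {P Q k} (f : List ℕ → List ℕ) →
           (∀ {σ} → P σ → Q (f σ)) →
           (∀ {σ τ} → P σ → P τ → f σ ≡ f τ → σ ≡ τ) →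
           (∀ {τ} → Q τ → ∃ λ σ → P σ × f σ ≡ τ) →
           Card P k → Card Q k
card-map {Q = Q} f f-Q inj surj (L , uL , eL , refl) =
  map f L ,
  unique-map uL (λ p q → inj (to (eL _) p) (to (eL _) q)) ,
  (λ τ → mk⇔ (λ τ∈ → let σ , σ∈ , τ≡ = ∈-map⁻ f τ∈ in subst Q (sym τ≡) (f-Q (to (eL _) σ∈)))
             (λ q → let σ , p , fσ≡τ = surj q in subst (_∈ map f L) fσ≡τ (∈-map⁺ f (from (eL _) p)))) ,
  Listₚ.length-map f L

card-cong : ∀ {P Q k} → (∀ {σ} → P σ → Q σ) → (∀ {σ} → Q σ → P σ) → Card P k → Card Q k
card-cong f g = card-map id f (λ _ _ → id) (λ q → _ , g q , refl)

card-⊎ : ∀ {P Q k l} → (∀ {σ} → P σ → ¬ Q σ) → Card P k → Card Q l →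
         Card (λ σ → P σ ⊎ Q σ) (k + l)
card-⊎ disj (L , uL , eL , refl) (M , uM , eM , refl) =
  L ++ M ,
  Uniqueₚ.++⁺ uL uM (λ (p , q) → disj (to (eL _) p) (to (eM _) q)) ,
  (λ σ → mk⇔ (λ p → [ (λ x → inj₁ (to (eL _) x)) , (λ x → inj₂ (to (eM _) x)) ]′ (∈-++⁻ L p))
             [ (λ x → ∈-++⁺ˡ (from (eL _) x)) , (λ x → ∈-++⁺ʳ L (from (eM _) x)) ]′) ,
  Listₚ.length-++ L

card-∅ : ∀ {P} → (∀ {σ} → ¬ P σ) → Card P 0
card-∅ ¬P = [] , [] , (λ σ → mk⇔ (λ ()) (λ p → ⊥-elim (¬P p))) , refl

length-filter-¬ : ∀ {A : Set} {Q : A → Set} (Q? : Decidable Q) xs →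
                  length xs ≡ length (filter Q? xs) + length (filter (¬? ∘ Q?) xs)
length-filter-¬ Q? [] = refl
length-filter-¬ Q? (x ∷ xs) with Q? x
... | yes _ = cong suc (length-filter-¬ Q? xs)
... | no  _ = trans (cong suc (length-filter-¬ Q? xs)) (sym (ℕₚ.+-suc _ _))

card-filter : ∀ {P Q k} (Q? : Decidable Q) ((L , _) : Card P k) →
              Card (λ σ → P σ × Q σ) (length (filter Q? L))
card-filter Q? (L , uL , eL , _) =
  filter Q? L , Uniqueₚ.filter⁺ Q? uL ,
  (λ σ → mk⇔ (λ p → let σ∈ , q = ∈-filter⁻ Q? p in to (eL σ) σ∈ , q)
             (λ (p , q) → ∈-filter⁺ Q? (from (eL σ) p) q)) ,
  refl

-- Filtering the enumeration of `P` gives both the intersection and the difference; `card-unique`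
-- identifies the size of the former with the given `l`.
card-∖ : ∀ {P Q k l} → Decidable Q → Card P k → Card (λ σ → P σ × Q σ) l →
         Card (λ σ → P σ × ¬ Q σ) (k ∸ l)
card-∖ {l = l} Q? cP@(L , _ , _ , refl) cQ = subst (Card _) size (card-filter (¬? ∘ Q?) cP)
  where
  size : length (filter (¬? ∘ Q?) L) ≡ length L ∸ l
  size = sym (trans (cong₂ _∸_ (length-filter-¬ Q? L) (card-unique cQ (card-filter Q? cP)))
                    (ℕₚ.m+n∸m≡n (length (filter Q? L)) _))

-- Positions in lists, and permutations as sets of points.

data At {A : Set} : List A → ℕ → A → Set where
  here  : ∀ {x xs} → At (x ∷ xs) 0 x
  there : ∀ {x xs i y} → At xs i y → At (x ∷ xs) (suc i) y

module _ {A : Set} where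

  At-functional : ∀ {xs : List A} {i x y} → At xs i x → At xs i y → x ≡ y
  At-functional here      here      = refl
  At-functional (there p) (there q) = At-functional p q

  At⇒∈ : ∀ {xs : List A} {i x} → At xs i x → x ∈ xs
  At⇒∈ here      = here refl
  At⇒∈ (there p) = there (At⇒∈ p)

  ∈⇒At : ∀ {xs : List A} {x} → x ∈ xs → ∃ λ i → At xs i x
  ∈⇒At (here refl) = 0 , here
  ∈⇒At (there p)   = let i , q = ∈⇒At p in suc i , there q

  At⇒< : ∀ {xs : List A} {i x} → At xs i x → i < length xs
  At⇒< here      = z<s
  At⇒< (there p) = s<s (At⇒< p)

  <⇒At : ∀ (xs : List A) {i} → i < length xs → ∃ λ x → At xs i x
  <⇒At (x ∷ xs) {zero}  _       = x , here
  <⇒At (x ∷ xs) {suc i} (s≤s p) = let y , q = <⇒At xs p in y , there q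

  At-injective : ∀ {xs : List A} {i j x} → Unique xs → At xs i x → At xs j x → i ≡ j
  At-injective _          here      here      = refl
  At-injective (x∉ ∷ _)   here      (there q) = contradiction refl (All.lookup x∉ (At⇒∈ q))
  At-injective (x∉ ∷ _)   (there p) here      = contradiction refl (All.lookup x∉ (At⇒∈ p))
  At-injective (_ ∷ uniq) (there p) (there q) = cong suc (At-injective uniq p q)

  At-injective⇒unique : ∀ {xs : List A} → (∀ {i j x} → At xs i x → At xs j x → i ≡ j) → Unique xs
  At-injective⇒unique {[]}     _   = []
  At-injective⇒unique {x ∷ xs} inj =
    All.tabulate (λ { y∈ refl → let i , p = ∈⇒At y∈ in contradiction (inj here (there p)) λ () })
    ∷ At-injective⇒unique (λ p q → ℕₚ.suc-injective (inj (there p) (there q)))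

  At-ext : ∀ {xs ys : List A} → length xs ≡ length ys →
           (∀ {i x} → At xs i x → At ys i x) → xs ≡ ys
  At-ext {[]}     {[]}     _  _ = refl
  At-ext {x ∷ xs} {y ∷ ys} eq f with f here
  ... | here = cong (x ∷_) (At-ext (ℕₚ.suc-injective eq) λ p → At-tail (f (there p)))
    where
    At-tail : ∀ {i z} → At (x ∷ ys) (suc i) z → At ys i z
    At-tail (there p) = p

At-map⁺ : ∀ {A B : Set} (f : A → B) {xs i x} → At xs i x → At (map f xs) i (f x)
At-map⁺ f here      = here
At-map⁺ f (there p) = there (At-map⁺ f p)

At-map⁻ : ∀ {A B : Set} (f : A → B) xs {i y} → At (map f xs) i y → ∃ λ x → At xs i x × f x ≡ y
At-map⁻ f (x ∷ xs) here      = x , here , refl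
At-map⁻ f (x ∷ xs) (there p) = let y , q , e = At-map⁻ f xs p in y , there q , e

module _ {n σ} (perm : IsPerm n σ) where

  private
    length≡ = proj₁ perm
    unique  = proj₁ (proj₂ perm)
    bounded = proj₂ (proj₂ perm)

  perm-value< : ∀ {i a} → At σ i a → a < n
  perm-value< p = All.lookup bounded (At⇒∈ p)

  perm-index< : ∀ {i a} → At σ i a → i < n
  perm-index< p = subst (_ <_) length≡ (At⇒< p)

  perm-injective : ∀ {i j a} → At σ i a → At σ j a → i ≡ j
  perm-injective = At-injective unique

  perm-at : ∀ {i} → i < n → ∃ λ a → At σ i a
  perm-at i<n = <⇒At σ (subst (_ <_) (sym length≡) i<n)

  -- Pigeonhole: if `a` were missing, `a ∷ σ` would consist of n + 1 distinct numbers below `n`.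
  perm-surjective : ∀ {a} → a < n → ∃ λ i → At σ i a
  perm-surjective {a} a<n with a ∈? σ
  ... | yes a∈σ = ∈⇒At a∈σ
  ... | no  a∉σ = contradiction too-long (ℕₚ.<-irrefl length≡)
    where
    too-long : length σ < n
    too-long = subst (suc (length σ) ≤_) (Listₚ.length-upTo n)
      (unique-⊆⇒length≤ {xs = a ∷ σ} (All.tabulate (λ { b∈ refl → a∉σ b∈ }) ∷ unique) λ
        { (here refl) → ∈-upTo⁺ a<n
        ; (there b∈)  → ∈-upTo⁺ (All.lookup bounded b∈) })

At⇒perm : ∀ {n σ} → length σ ≡ n → (∀ {i a} → At σ i a → a < n) →
          (∀ {i j a} → At σ i a → At σ j a → i ≡ j) → IsPerm n σ
At⇒perm len bound inj =
  len , At-injective⇒unique inj , All.tabulate (λ a∈ → bound (proj₂ (∈⇒At a∈)))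

-- Pattern occurrences as quadruples of positions.

-- The letters are listed by position, while the hypotheses of each constructor list them by
-- increasing value, so that three inequalities fix the order type.
data Bad (a b c d : ℕ) : Set where
  bad-2143 : b < a → a < d → d < c → Bad a b c d
  bad-3142 : b < d → d < a → a < c → Bad a b c d
  bad-3412 : c < d → d < a → a < b → Bad a b c d

Av : List ℕ → Set
Av σ = ∀ {i j k l a b c d} → i < j → j < k → k < l →
       At σ i a → At σ j b → At σ k c → At σ l d → ¬ Bad a b c d

infixr 5 _at_then_

-- Mediates between sublists and increasing sequences of positions: the index is a lower bound for
-- the position of the next entry.
data Occurs (σ : List ℕ) : ℕ → List ℕ → Set where
  []   : ∀ {i} → Occurs σ i []
  _at_then_ : ∀ {i j x s} → i ≤ j → At σ j x → Occurs σ (suc j) s → Occurs σ i (x ∷ s)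

occurs-∷ : ∀ {y σ i s} → Occurs σ i s → Occurs (y ∷ σ) (suc i) s
occurs-∷ []            = []
occurs-∷ (i≤j at p then o) = s≤s i≤j at there p then occurs-∷ o

occurs-tail : ∀ {y σ i s} → Occurs (y ∷ σ) (suc i) s → Occurs σ i s
occurs-tail []                      = []
occurs-tail (s≤s i≤j at there p then o) = i≤j at p then occurs-tail o

occurs-weaken : ∀ {σ i s} → Occurs σ (suc i) s → Occurs σ 0 s
occurs-weaken []          = []
occurs-weaken (_ at p then o) = z≤n at p then o

⊆⇒occurs : ∀ {s σ} → s ⊆ σ → Occurs σ 0 s
⊆⇒occurs []         = []
⊆⇒occurs (y ∷ʳ sub) = occurs-weaken (occurs-∷ (⊆⇒occurs sub))
⊆⇒occurs (refl ∷ sub) = z≤n at here then occurs-∷ (⊆⇒occurs sub)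

occurs⇒⊆ : ∀ σ {s} → Occurs σ 0 s → s ⊆ σ
occurs⇒⊆ σ       []                  = minimum σ
occurs⇒⊆ (y ∷ σ) (_ at here then o)      = refl ∷ occurs⇒⊆ σ (occurs-tail o)
occurs⇒⊆ (y ∷ σ) (_ at there p then o)   = y ∷ʳ occurs⇒⊆ σ (z≤n at p then occurs-tail o)

-- The entry playing the role of a given letter of a pattern; junk outside
-- the letters 1, 2, 3, 4.
rank : ℕ → ℕ → ℕ → ℕ → ℕ → ℕ
rank w x y z 1 = w
rank w x y z 2 = x
rank w x y z 3 = y
rank w x y z _ = z

Letter : ℕ → Set
Letter i = 1 ≤ i × i ≤ 4

module _ {w x y z} (w<x : w < x) (x<y : x < y) (y<z : y < z) where

  rank-mono : ∀ {i j} → Letter i → Letter j → i < j → rank w x y z i < rank w x y z j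
  rank-mono {1} {2} _ _ _ = w<x
  rank-mono {1} {3} _ _ _ = ℕₚ.<-trans w<x x<y
  rank-mono {1} {4} _ _ _ = ℕₚ.<-trans w<x (ℕₚ.<-trans x<y y<z)
  rank-mono {2} {3} _ _ _ = x<y
  rank-mono {2} {4} _ _ _ = ℕₚ.<-trans x<y y<z
  rank-mono {3} {4} _ _ _ = y<z
  rank-mono {0} (() , _)
  rank-mono {_} {suc (suc (suc (suc (suc _))))} _ (_ , s≤s (s≤s (s≤s (s≤s ()))))
  rank-mono {1} {1} _ _ (s≤s ())
  rank-mono {suc (suc _)} {1} _ _ (s≤s ())
  rank-mono {suc (suc _)} {2} _ _ (s≤s (s≤s ()))
  rank-mono {suc (suc (suc _))} {3} _ _ (s≤s (s≤s (s≤s ())))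
  rank-mono {suc (suc (suc (suc _)))} {4} _ _ (s≤s (s≤s (s≤s (s≤s ()))))

  rank-orderIso : ∀ {τ} → All Letter τ → OrderIso (map (rank w x y z) τ) τ
  rank-orderIso {τ} letters = Listₚ.length-map _ τ , iso
    where
    zip-rank : ∀ {τ p} → p ∈ zip (map (rank w x y z) τ) τ →
               proj₁ p ≡ rank w x y z (proj₂ p) × proj₂ p ∈ τ
    zip-rank {_ ∷ _} (here refl) = refl , here refl
    zip-rank {_ ∷ τ} (there p∈)  = map₂ there (zip-rank {τ} p∈)
    iso : ∀ p q → p ∈ zip (map (rank w x y z) τ) τ → q ∈ zip (map (rank w x y z) τ) τ →
          (proj₁ p < proj₁ q) ⇔ (proj₂ p < proj₂ q)
    iso (_ , i) (_ , j) p∈ q∈ with zip-rank {τ} p∈ | zip-rank {τ} q∈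
    ... | refl , i∈ | refl , j∈ = mk⇔ reflects (rank-mono (All.lookup letters i∈) (All.lookup letters j∈))
      where
      reflects : rank w x y z i < rank w x y z j → i < j
      reflects lt with ℕₚ.<-cmp i j
      ... | tri< i<j _ _    = i<j
      ... | tri≈ _ refl _   = contradiction lt (ℕₚ.<-irrefl refl)
      ... | tri> _ _ j<i    =
        contradiction lt (ℕₚ.<-asym (rank-mono (All.lookup letters j∈) (All.lookup letters i∈) j<i))

private
  p₁ : ∀ {A : Set} {a b c d : A} → a ∈ a ∷ b ∷ c ∷ d ∷ []
  p₁ = here refl
  p₂ : ∀ {A : Set} {a b c d : A} → b ∈ a ∷ b ∷ c ∷ d ∷ []
  p₂ = there (here refl)
  p₃ : ∀ {A : Set} {a b c d : A} → c ∈ a ∷ b ∷ c ∷ d ∷ []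
  p₃ = there (there (here refl))
  p₄ : ∀ {A : Set} {a b c d : A} → d ∈ a ∷ b ∷ c ∷ d ∷ []
  p₄ = there (there (there (here refl)))

AvoidsT : List ℕ → Set
AvoidsT σ = Avoids σ (2 ∷ 1 ∷ 4 ∷ 3 ∷ [])
          × Avoids σ (3 ∷ 1 ∷ 4 ∷ 2 ∷ [])
          × Avoids σ (3 ∷ 4 ∷ 1 ∷ 2 ∷ [])

letter₁ : Letter 1
letter₁ = s≤s z≤n , s≤s z≤n
letter₂ : Letter 2
letter₂ = s≤s z≤n , s≤s (s≤s z≤n)
letter₃ : Letter 3
letter₃ = s≤s z≤n , s≤s (s≤s (s≤s z≤n))
letter₄ : Letter 4
letter₄ = s≤s z≤n , s≤s (s≤s (s≤s (s≤s z≤n)))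

avoidsT⇒Av : ∀ {σ} → AvoidsT σ → Av σ
avoidsT⇒Av {σ} (av₁ , av₂ , av₃) i<j j<k k<l p q r s = λ
  { (bad-2143 b<a a<d d<c) →
      av₁ (_ , sub , rank-orderIso b<a a<d d<c (letter₂ ∷ letter₁ ∷ letter₄ ∷ letter₃ ∷ []))
  ; (bad-3142 b<d d<a a<c) →
      av₂ (_ , sub , rank-orderIso b<d d<a a<c (letter₃ ∷ letter₁ ∷ letter₄ ∷ letter₂ ∷ []))
  ; (bad-3412 c<d d<a a<b) →
      av₃ (_ , sub , rank-orderIso c<d d<a a<b (letter₃ ∷ letter₄ ∷ letter₁ ∷ letter₂ ∷ [])) }
  where
  sub = occurs⇒⊆ σ (z≤n at p then i<j at q then j<k at r then k<l at s then [])

Av⇒avoids : ∀ {σ s t u v} →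
  (∀ {a b c d} → OrderIso (a ∷ b ∷ c ∷ d ∷ []) (s ∷ t ∷ u ∷ v ∷ []) → Bad a b c d) →
  Av σ → Avoids σ (s ∷ t ∷ u ∷ v ∷ [])
Av⇒avoids bad av (a ∷ b ∷ c ∷ d ∷ [] , sub , iso) with ⊆⇒occurs sub
... | _ at p then i<j at q then j<k at r then k<l at s then [] = av i<j j<k k<l p q r s (bad iso)
Av⇒avoids bad av ([] , _ , () , _)
Av⇒avoids bad av (_ ∷ [] , _ , () , _)
Av⇒avoids bad av (_ ∷ _ ∷ [] , _ , () , _)
Av⇒avoids bad av (_ ∷ _ ∷ _ ∷ [] , _ , () , _)
Av⇒avoids bad av (_ ∷ _ ∷ _ ∷ _ ∷ _ ∷ _ , _ , () , _)

Av⇒avoidsT : ∀ {σ} → Av σ → AvoidsT σ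
Av⇒avoidsT av =
    -- The isomorphism is consulted only for the letter pairs 1 < 2, 2 < 3 and 3 < 4, which give the
    -- inequalities of `Bad` in order.
    Av⇒avoids (λ (_ , iso) → bad-2143 (from (iso _ _ p₂ p₁) (s<s z<s))
                                      (from (iso _ _ p₁ p₄) (s<s (s<s z<s)))
                                      (from (iso _ _ p₄ p₃) (s<s (s<s (s<s z<s))))) av
  , Av⇒avoids (λ (_ , iso) → bad-3142 (from (iso _ _ p₂ p₄) (s<s z<s))
                                      (from (iso _ _ p₄ p₁) (s<s (s<s z<s)))
                                      (from (iso _ _ p₁ p₃) (s<s (s<s (s<s z<s))))) av
  , Av⇒avoids (λ (_ , iso) → bad-3412 (from (iso _ _ p₃ p₄) (s<s z<s))
                                      (from (iso _ _ p₄ p₁) (s<s (s<s z<s)))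
                                      (from (iso _ _ p₁ p₂) (s<s (s<s (s<s z<s))))) av

Avoider : ℕ → Pred
Avoider n σ = IsPerm n σ × Av σ

card-Avoider⇒CardSnT : ∀ {n k} → Card (Avoider n) k → CardSnT n k
card-Avoider⇒CardSnT = card-cong (λ (perm , av) → perm , Av⇒avoidsT av) (λ (perm , av) → perm , avoidsT⇒Av av)

-- The quarter turn of the diagram.

-- A value that does not occur gets the junk position `length σ`. For a permutation, `rot` asks only
-- for values that occur.
pos : List ℕ → ℕ → ℕ
pos []      a = 0
pos (x ∷ σ) a with x ℕₚ.≟ a
... | yes _ = 0
... | no  _ = suc (pos σ a)

At-pos : ∀ {σ i a} → At σ i a → At σ (pos σ a) a
At-pos {x ∷ σ} {a = a} p with x ℕₚ.≟ a | p
... | yes refl | _       = here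
... | no  x≢a  | here    = contradiction refl x≢a
... | no  _    | there q = there (At-pos q)

-- Rotates the diagram {(i , σᵢ)} of a permutation of {0 , … , n} by a
-- quarter turn: (i , a) becomes (n - a , i).
rot : List ℕ → List ℕ
rot σ = map (pos σ) (downFrom (length σ))

At-downFrom : ∀ {n i a} → suc (i + a) ≡ n → At (downFrom n) i a
At-downFrom {i = zero}  refl = here
At-downFrom {i = suc i} refl = there (At-downFrom refl)

At-downFrom⁻ : ∀ {n i a} → At (downFrom n) i a → suc (i + a) ≡ n
At-downFrom⁻ {suc n} here      = refl
At-downFrom⁻ {suc n} (there p) = cong suc (At-downFrom⁻ p)

length-rot : ∀ σ → length (rot σ) ≡ length σ
length-rot σ = trans (Listₚ.length-map (pos σ) (downFrom (length σ))) (Listₚ.length-downFrom (length σ))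

module _ {n σ} (perm : IsPerm n σ) where

  At-rot⁺ : ∀ {i j a} → suc (j + a) ≡ n → At σ i a → At (rot σ) j i
  At-rot⁺ {i} {j} {a} eq p = subst (At (rot σ) j) (perm-injective perm (At-pos p) p)
    (At-map⁺ (pos σ) (At-downFrom (trans eq (sym (proj₁ perm)))))

  At-rot⁻ : ∀ {i j} → At (rot σ) j i → ∃ λ a → suc (j + a) ≡ n × At σ i a
  At-rot⁻ {i} {j} p with At-map⁻ (pos σ) (downFrom (length σ)) p
  ... | a , q , refl = a , eq , At-pos (proj₂ (perm-surjective perm a<n))
    where
    eq : suc (j + a) ≡ n
    eq = trans (At-downFrom⁻ q) (proj₁ perm)
    a<n : a < n
    a<n = subst (a <_) eq (s≤s (ℕₚ.m≤n+m a j))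

  rot-perm : IsPerm n (rot σ)
  rot-perm = At⇒perm (trans (length-rot σ) (proj₁ perm)) bound inj
    where
    bound : ∀ {j i} → At (rot σ) j i → i < n
    bound p = let _ , _ , q = At-rot⁻ p in perm-index< perm q
    inj : ∀ {j k i} → At (rot σ) j i → At (rot σ) k i → j ≡ k
    inj p q with At-rot⁻ p | At-rot⁻ q
    ... | a , eq₁ , p′ | b , eq₂ , q′ with At-functional p′ q′
    ... | refl = ℕₚ.+-cancelʳ-≡ a _ _ (ℕₚ.suc-injective (trans eq₁ (sym eq₂)))

+-antitone : ∀ {i j a b n} → suc (i + a) ≡ n → suc (j + b) ≡ n → i < j → b < a
+-antitone {i} {j} {a} {b} eq₁ eq₂ i<j = ℕₚ.≰⇒> λ a≤b →
  ℕₚ.<-irrefl (ℕₚ.suc-injective (trans eq₁ (sym eq₂))) (ℕₚ.+-mono-<-≤ i<j a≤b)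

-- Read back through the turn, the values of an occurrence become positions, and its positions, in
-- reverse, become values. This exchanges 2143 with 3412 and fixes 3142.
rot-Av : ∀ {n σ} → IsPerm n σ → Av σ → Av (rot σ)
rot-Av perm av i<j j<k k<l p q r s bad
  with At-rot⁻ perm p | At-rot⁻ perm q | At-rot⁻ perm r | At-rot⁻ perm s
... | _ , e₁ , p′ | _ , e₂ , q′ | _ , e₃ , r′ | _ , e₄ , s′ = turn bad
  where
  b<a = +-antitone e₁ e₂ i<j
  c<b = +-antitone e₂ e₃ j<k
  d<c = +-antitone e₃ e₄ k<l
  turn : ¬ Bad _ _ _ _
  turn (bad-2143 x y z) = av x y z q′ p′ s′ r′ (bad-3412 d<c c<b b<a)
  turn (bad-3142 x y z) = av x y z q′ s′ p′ r′ (bad-3142 d<c c<b b<a)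
  turn (bad-3412 x y z) = av x y z r′ s′ p′ q′ (bad-2143 d<c c<b b<a)

complement : ∀ {i n} → i < n → ∃ λ j → suc (i + j) ≡ n
complement {i} {n} i<n = n ∸ suc i , ℕₚ.m+[n∸m]≡n i<n

suc-+-flip : ∀ i j {n} → suc (i + j) ≡ n → suc (j + i) ≡ n
suc-+-flip i j eq = trans (cong suc (ℕₚ.+-comm j i)) eq

-- Writing i′ = n - 1 - i and a′ = n - 1 - a, a point travels through (i, a), (a′, i), (i′, a′), (a,
-- i′) and back to (i, a).
rot⁴ : ∀ {n σ} → IsPerm n σ → rot (rot (rot (rot σ))) ≡ σ
rot⁴ {n} {σ} perm = sym (At-ext len λ p →
  let i′ , eq-i = complement (perm-index< perm p)
      a′ , eq-a = complement (perm-value< perm p)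
  in At-rot⁺ perm₃ eq-i (At-rot⁺ perm₂ eq-a
       (At-rot⁺ perm₁ (suc-+-flip _ i′ eq-i) (At-rot⁺ perm (suc-+-flip _ a′ eq-a) p))))
  where
  perm₁ = rot-perm perm
  perm₂ = rot-perm perm₁
  perm₃ = rot-perm perm₂
  len : length σ ≡ length (rot (rot (rot (rot σ))))
  len = trans (proj₁ perm) (sym (proj₁ (rot-perm perm₃)))

rot-injective : ∀ {n σ τ} → IsPerm n σ → IsPerm n τ → rot σ ≡ rot τ → σ ≡ τ
rot-injective permσ permτ eq =
  trans (sym (rot⁴ permσ)) (trans (cong (rot ∘ rot ∘ rot) eq) (rot⁴ permτ))

-- The two kinds of avoiders exchanged by the quarter turn.

-- With `r = 0` these are the objects counted by h(n, k). Positions and values start at 0, so the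
-- length is n + 1 and the maximum is `n`; the bound `r` on the first entry is what the downward
-- induction runs on.
record Rising (n k r : ℕ) (σ : List ℕ) : Set where
  field
    perm    : IsPerm (suc n) σ
    avoid   : Av σ
    top     : At σ k n
    incr    : ∀ {i j a b} → i < j → j ≤ k → At σ i a → At σ j b → a < b
    low     : ∀ {a} → At σ 0 a → r ≤ a

record Falling (n r : ℕ) (σ : List ℕ) : Set where
  field
    perm    : IsPerm (suc n) σ
    avoid   : Av σ
    first   : At σ 0 r
    decr    : ∀ {i j a b} → i < j → At σ i a → At σ j b → b < r → b < a

-- The turn sends the maximum, the point (k, n), to the first entry `k`, and the increasing run to
-- its left to the values below `k` in decreasing order.
Rising⇒Falling-rot : ∀ {n k σ} → Rising n k 0 σ → Falling n k (rot σ)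
Rising⇒Falling-rot {n} {k} {σ} w = record
  { perm  = rot-perm perm
  ; avoid = rot-Av perm avoid
  ; first = At-rot⁺ perm refl top
  ; decr  = decr
  }
  where
  open Rising w
  decr : ∀ {i j a b} → i < j → At (rot σ) i a → At (rot σ) j b → b < k → b < a
  decr {a = a} {b} i<j p q b<k with At-rot⁻ perm p | At-rot⁻ perm q
  ... | x , eq₁ , p′ | y , eq₂ , q′ with ℕₚ.<-cmp b a | +-antitone eq₁ eq₂ i<j
  ... | tri< b<a _ _  | _   = b<a
  ... | tri≈ _ refl _ | y<x = contradiction y<x (ℕₚ.<-irrefl (At-functional q′ p′))
  ... | tri> _ _ a<b  | y<x = contradiction (incr a<b (ℕₚ.<⇒≤ b<k) p′ q′) (ℕₚ.<-asym y<x)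

Falling-rot⇒Rising : ∀ {n k σ} → IsPerm (suc n) σ → Av σ → Falling n k (rot σ) → Rising n k 0 σ
Falling-rot⇒Rising {n} {k} {σ} permσ av d = record
  { perm  = permσ
  ; avoid = av
  ; top   = top
  ; incr  = incr
  ; low   = λ _ → z≤n
  }
  where
  open Falling d
  top : At σ k n
  top with At-rot⁻ permσ first
  ... | _ , refl , p = p
  incr : ∀ {i j a b} → i < j → j ≤ k → At σ i a → At σ j b → a < b
  incr {i} {j} {a} {b} i<j j≤k p q with ℕₚ.<-cmp a b
  ... | tri< a<b _ _  = a<b
  ... | tri≈ _ refl _ = contradiction i<j (ℕₚ.<-irrefl (perm-injective permσ p q))
  -- `decr` concerns only values strictly below the first entry, so position `k` itself is settled
  -- separately: it holds the maximum.
  ... | tri> _ _ b<a with ℕₚ.m≤n⇒m<n∨m≡n j≤k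
  ...   | inj₂ refl = contradiction b<a (ℕₚ.≤⇒≯ (subst (a ≤_) (At-functional top q)
                                                  (ℕ.s≤s⁻¹ (perm-value< permσ p))))
  ...   | inj₁ j<k  =
    let a′ , eq-a = complement (perm-value< permσ p)
        b′ , eq-b = complement (perm-value< permσ q)
        a′<b′     = +-antitone eq-b eq-a b<a
    in contradiction i<j (ℕₚ.<-asym
         (decr a′<b′ (At-rot⁺ permσ (suc-+-flip a a′ eq-a) p) (At-rot⁺ permσ (suc-+-flip b b′ eq-b) q) j<k))

card-rot : ∀ {n k m} → Card (Rising n k 0) m → Card (Falling n k) m
card-rot {n} {k} = card-map rot Rising⇒Falling-rot
  (λ w w′ → rot-injective (Rising.perm w) (Rising.perm w′)) surj
  where
  surj : ∀ {τ} → Falling n k τ → ∃ λ σ → Rising n k 0 σ × rot σ ≡ τ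
  -- As the turn has order four, its cube provides the preimage.
  surj {τ} d = rot (rot (rot τ)) ,
    Falling-rot⇒Rising (rot-perm perm₂)
            (rot-Av perm₂ (rot-Av perm₁ (rot-Av (Falling.perm d) (Falling.avoid d))))
            (subst (Falling n k) (sym (rot⁴ (Falling.perm d))) d) ,
    rot⁴ (Falling.perm d)
    where
    perm₁ = rot-perm (Falling.perm d)
    perm₂ = rot-perm perm₁

-- Monotone relabelling and a leading maximum.

Monotone : (ℕ → ℕ) → Set
Monotone f = ∀ {a b} → a < b → f a < f b

monotone-reflects : ∀ {f a b} → Monotone f → f a < f b → a < b
monotone-reflects {f} {a} {b} mono lt with ℕₚ.<-cmp a b
... | tri< a<b _ _  = a<b
... | tri≈ _ refl _ = contradiction lt (ℕₚ.<-irrefl refl)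
... | tri> _ _ b<a  = contradiction lt (ℕₚ.<-asym (mono b<a))

monotone-injective : ∀ {f a b} → Monotone f → f a ≡ f b → a ≡ b
monotone-injective {f} {a} {b} mono eq with ℕₚ.<-cmp a b
... | tri< a<b _ _ = contradiction (mono a<b) (ℕₚ.<-irrefl eq)
... | tri≈ _ e _   = e
... | tri> _ _ b<a = contradiction (mono b<a) (ℕₚ.<-irrefl (sym eq))

bad-map : ∀ {f a b c d} → Monotone f → Bad a b c d → Bad (f a) (f b) (f c) (f d)
bad-map m (bad-2143 x y z) = bad-2143 (m x) (m y) (m z)
bad-map m (bad-3142 x y z) = bad-3142 (m x) (m y) (m z)
bad-map m (bad-3412 x y z) = bad-3412 (m x) (m y) (m z)

bad-reflect : ∀ {f a b c d} → Monotone f → Bad (f a) (f b) (f c) (f d) → Bad a b c d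
bad-reflect m (bad-2143 x y z) =
  bad-2143 (monotone-reflects m x) (monotone-reflects m y) (monotone-reflects m z)
bad-reflect m (bad-3142 x y z) =
  bad-3142 (monotone-reflects m x) (monotone-reflects m y) (monotone-reflects m z)
bad-reflect m (bad-3412 x y z) =
  bad-3412 (monotone-reflects m x) (monotone-reflects m y) (monotone-reflects m z)

-- No pattern in T begins with its largest letter, so a maximum can never start an occurrence.
bad⇒first<second⊎third : ∀ {a b c d} → Bad a b c d → a < b ⊎ a < c
bad⇒first<second⊎third (bad-2143 _ a<d d<c) = inj₂ (ℕₚ.<-trans a<d d<c)
bad⇒first<second⊎third (bad-3142 _ _ a<c)   = inj₂ a<c
bad⇒first<second⊎third (bad-3412 _ _ a<b)   = inj₁ a<b

Av-embed : ∀ {σ τ} (φ ψ : ℕ → ℕ) → Monotone φ → Monotone ψ →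
           (∀ {i a} → At σ i a → At τ (φ i) (ψ a)) → Av τ → Av σ
Av-embed φ ψ φ-mono ψ-mono emb av i<j j<k k<l p q r s bad =
  av (φ-mono i<j) (φ-mono j<k) (φ-mono k<l) (emb p) (emb q) (emb r) (emb s) (bad-map ψ-mono bad)

Av-tail : ∀ {x σ} → Av (x ∷ σ) → Av σ
Av-tail = Av-embed suc id s<s id there

Av-map⁺ : ∀ {f σ} → Monotone f → Av σ → Av (map f σ)
Av-map⁺ {f} {σ} mono av i<j j<k k<l p q r s bad
  with At-map⁻ f σ p | At-map⁻ f σ q | At-map⁻ f σ r | At-map⁻ f σ s
... | _ , p′ , refl | _ , q′ , refl | _ , r′ , refl | _ , s′ , refl =
  av i<j j<k k<l p′ q′ r′ s′ (bad-reflect mono bad)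

perm-∷-max : ∀ {n σ} → IsPerm n σ → IsPerm (suc n) (n ∷ σ)
perm-∷-max (len , uniq , bound) =
  cong suc len ,
  All.map (λ a<n → ℕₚ.<⇒≢ a<n ∘ sym) bound ∷ uniq ,
  ℕₚ.≤-refl ∷ All.map ℕₚ.m<n⇒m<1+n bound

all<∧≢ : ∀ {n σ} → All (_< suc n) σ → All (n ≢_) σ → All (_< n) σ
all<∧≢ bound n∉ = All.zipWith (λ (a≤n , n≢a) → ℕₚ.≤∧≢⇒< (ℕ.s≤s⁻¹ a≤n) (n≢a ∘ sym)) (bound , n∉)

perm-∷-max⁻ : ∀ {n σ} → IsPerm (suc n) (n ∷ σ) → IsPerm n σ
perm-∷-max⁻ (len , n∉ ∷ uniq , _ ∷ bound) = ℕₚ.suc-injective len , uniq , all<∧≢ bound n∉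

Avoider-∷-max : ∀ {n σ} → Avoider n σ → Avoider (suc n) (n ∷ σ)
Avoider-∷-max {n} {σ} (perm , av) = perm-∷-max perm , av′
  where
  av′ : Av (n ∷ σ)
  av′ (s≤s i<j) (s≤s j<k) (s≤s k<l) (there p) (there q) (there r) (there s) = av i<j j<k k<l p q r s
  av′ i<j j<k k<l here (there q) (there r) _ bad with bad⇒first<second⊎third bad
  ... | inj₁ n<b = ℕₚ.<-asym n<b (perm-value< perm q)
  ... | inj₂ n<c = ℕₚ.<-asym n<c (perm-value< perm r)

Avoider-∷-max⁻ : ∀ {n σ} → Avoider (suc n) (n ∷ σ) → Avoider n σ
Avoider-∷-max⁻ (perm , av) = perm-∷-max⁻ perm , Av-tail av

-- When the maximum stands first the run before it is empty, and the rest is an arbitrary avoider.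
-- This is the meaning of h(n, 0).
card-Avoider⇒Rising : ∀ {n m} → Card (Avoider n) m → Card (Rising n 0 0) m
card-Avoider⇒Rising {n} = card-map (n ∷_) forward (λ _ _ → Listₚ.∷-injectiveʳ) backward
  where
  forward : ∀ {σ} → Avoider n σ → Rising n 0 0 (n ∷ σ)
  forward s = record
    { perm  = proj₁ (Avoider-∷-max s)
    ; avoid = proj₂ (Avoider-∷-max s)
    ; top   = here
    ; incr  = λ { (s≤s _) () }
    ; low   = λ _ → z≤n
    }
  backward : ∀ {τ} → Rising n 0 0 τ → ∃ λ σ → Avoider n σ × n ∷ σ ≡ τ
  backward {x ∷ σ} w with Rising.top w
  ... | here = σ , Avoider-∷-max⁻ (Rising.perm w , Rising.avoid w) , refl

-- Decomposition by the first entry.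

RisingFrom : ℕ → ℕ → ℕ → Pred
RisingFrom n k r σ = Rising n k r σ × At σ 0 r

insertSecond : ℕ → List ℕ → List ℕ
insertSecond x []      = []
insertSecond x (y ∷ σ) = y ∷ x ∷ σ

insertSecond-injective : ∀ {x σ τ} → insertSecond x σ ≡ insertSecond x τ → σ ≡ τ
insertSecond-injective {σ = []}    {[]}    _    = refl
insertSecond-injective {σ = _ ∷ _} {_ ∷ _} refl = refl

insertSecond-perm : ∀ {n y σ} → IsPerm n (y ∷ σ) → IsPerm (suc n) (y ∷ n ∷ σ)
insertSecond-perm (len , y∉ ∷ uniq , y<n ∷ bound) =
  cong suc len ,
  (ℕₚ.<⇒≢ y<n ∷ y∉) ∷ All.map (λ a<n → ℕₚ.<⇒≢ a<n ∘ sym) bound ∷ uniq ,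
  ℕₚ.m<n⇒m<1+n y<n ∷ ℕₚ.≤-refl ∷ All.map ℕₚ.m<n⇒m<1+n bound

insertSecond-perm⁻ : ∀ {n y σ} → IsPerm (suc n) (y ∷ n ∷ σ) → IsPerm n (y ∷ σ)
insertSecond-perm⁻ (len , (y≢n ∷ y∉) ∷ n∉ ∷ uniq , y≤n ∷ _ ∷ bound) =
  ℕₚ.suc-injective len , y∉ ∷ uniq , all<∧≢ (y≤n ∷ bound) ((y≢n ∘ sym) ∷ n∉)

At-skip : ∀ {x y : ℕ} {σ i a} → 2 ≤ i → At (y ∷ x ∷ σ) i a → At (y ∷ σ) (ℕ.pred i) a
At-skip _       (there (there p)) = there p
At-skip (s≤s ()) (there here)

pred-< : ∀ {i j} → 1 ≤ i → i < j → ℕ.pred i < ℕ.pred j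
pred-< (s≤s _) (s≤s i<j) = i<j

-- Standing second, the new maximum could only be a first or a second letter. It cannot be the
-- first; as the second it must be the 4 of a 3412 whose 3 is `r`, and then the letters 1 and 2
-- would form an ascent below `r`.
insertSecond-Av : ∀ {n r σ} → Falling n r (r ∷ σ) → Av (r ∷ suc n ∷ σ)
insertSecond-Av {n} {r} {σ} d {i} {j} {k} {l} {a} {b} {c} {e} i<j j<k k<l p q u v = go p q
  where
  open Falling d
  2≤k : 2 ≤ k
  2≤k = ℕₚ.≤-trans (s≤s (ℕₚ.≤-trans (s≤s z≤n) i<j)) j<k
  u′ : At (r ∷ σ) (ℕ.pred k) c
  u′ = At-skip 2≤k u
  v′ : At (r ∷ σ) (ℕ.pred l) e
  v′ = At-skip (ℕₚ.≤-trans 2≤k (ℕₚ.<⇒≤ k<l)) v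
  k<l′ : ℕ.pred k < ℕ.pred l
  k<l′ = pred-< (ℕₚ.<⇒≤ 2≤k) k<l
  go : At (r ∷ suc n ∷ σ) i a → At (r ∷ suc n ∷ σ) j b → ¬ Bad a b c e
  go here (there here) (bad-2143 b<a _ _) = ℕₚ.<-asym b<a (perm-value< perm here)
  go here (there here) (bad-3142 b<e _ _) = ℕₚ.<-asym b<e (perm-value< perm v′)
  go here (there here) (bad-3412 c<e e<a _) = ℕₚ.<-asym c<e (decr k<l′ u′ v′ e<a)
  go here (there (there q′)) = avoid z<s (pred-< (s≤s z≤n) j<k) k<l′ here (there q′) u′ v′
  go (there here) q bad with bad⇒first<second⊎third bad
  ... | inj₁ a<b = ℕₚ.<-asym a<b (perm-value< perm (At-skip i<j q))
  ... | inj₂ a<c = ℕₚ.<-asym a<c (perm-value< perm u′)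
  go (there (there p′)) q =
    avoid (pred-< (s≤s z≤n) i<j) (pred-< (ℕₚ.≤-trans (s≤s z≤n) i<j) j<k) k<l′
          (there p′) (At-skip (ℕₚ.≤-trans (s≤s (s≤s z≤n)) (ℕₚ.<⇒≤ i<j)) q) u′ v′

Falling⇒RisingFrom : ∀ {n r σ} → Falling n r σ → RisingFrom (suc n) 1 r (insertSecond (suc n) σ)
Falling⇒RisingFrom {n} {r} {x ∷ σ} d with Falling.first d
... | here = record
  { perm  = insertSecond-perm (Falling.perm d)
  ; avoid = insertSecond-Av d
  ; top   = there here
  ; incr  = incr
  ; low   = λ { here → ℕₚ.≤-refl }
  } , here
  where
  incr : ∀ {i j a b} → i < j → j ≤ 1 → At (r ∷ suc n ∷ σ) i a → At (r ∷ suc n ∷ σ) j b → a < b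
  incr _ _ here (there here) = perm-value< (Falling.perm d) here
  incr (s≤s ()) _ (there _) (there here)
  incr _ (s≤s ()) _ (there (there _))

RisingFrom⇒Falling : ∀ {n r τ} → RisingFrom (suc n) 1 r τ → ∃ λ σ → Falling n r σ × insertSecond (suc n) σ ≡ τ
RisingFrom⇒Falling {n} {r} {_ ∷ _ ∷ σ} (w , here) with Rising.top w
... | there here = r ∷ σ , record
  { perm  = perm′
  ; avoid = Av-embed φ id φ-mono id emb (Rising.avoid w)
  ; first = here
  ; decr  = decr
  } , refl
  where
  perm′ : IsPerm (suc n) (r ∷ σ)
  perm′ = insertSecond-perm⁻ (Rising.perm w)
  φ : ℕ → ℕ
  φ zero    = zero
  φ (suc i) = suc (suc i)
  φ-mono : Monotone φ
  φ-mono {zero}  {suc _} _         = z<s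
  φ-mono {suc _} {suc _} (s≤s i<j) = s<s (s<s i<j)
  emb : ∀ {i a} → At (r ∷ σ) i a → At (r ∷ suc n ∷ σ) (φ i) a
  emb here      = here
  emb (there p) = there (there p)
  decr : ∀ {i j a b} → i < j → At (r ∷ σ) i a → At (r ∷ σ) j b → b < r → b < a
  decr _ here (there _) b<r = b<r
  decr {a = a} {b} (s≤s i<j) (there p) (there q) b<r with ℕₚ.<-cmp b a
  ... | tri< b<a _ _  = b<a
  ... | tri≈ _ refl _ = contradiction i<j (ℕₚ.<-irrefl (ℕₚ.suc-injective (perm-injective perm′ (there p) (there q))))
  -- Together with `r` and the maximum next to it, an ascent below `r` is an occurrence of 3412.
  ... | tri> _ _ a<b  = contradiction (bad-3412 a<b b<r (perm-value< perm′ here))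
    (Rising.avoid w z<s (s<s z<s) (s<s (s<s i<j)) here (there here) (there (there p)) (there (there q)))

card-Falling⇒RisingFrom : ∀ {n r m} → Card (Falling n r) m → Card (RisingFrom (suc n) 1 r) m
card-Falling⇒RisingFrom =
  card-map (insertSecond _) Falling⇒RisingFrom (λ _ _ → insertSecond-injective) RisingFrom⇒Falling

FallingFirst : ℕ → Pred
FallingFirst n σ = ∃ λ r → Falling n r σ

Rising-relax : ∀ {n k r s σ} → Rising n k r σ → (∀ {a} → At σ 0 a → s ≤ a) → Rising n k s σ
Rising-relax w low′ = record
  { perm = perm ; avoid = avoid ; top = top ; incr = incr ; low = low′ }
  where open Rising w

removeSecond : List ℕ → List ℕ
removeSecond []          = []
removeSecond (x ∷ [])    = x ∷ []
removeSecond (y ∷ x ∷ σ) = y ∷ σ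

removeSecond-insertSecond : ∀ x σ → removeSecond (insertSecond x σ) ≡ σ
removeSecond-insertSecond x []      = refl
removeSecond-insertSecond x (y ∷ σ) = refl

Rising⇒FallingFirst : ∀ {n τ} → Rising (suc n) 1 0 τ → ∃ λ σ → FallingFirst n σ × insertSecond (suc n) σ ≡ τ
Rising⇒FallingFirst {n} {y ∷ τ} w =
  -- Every first entry `y` can serve as its own lower bound.
  let σ , d , eq = RisingFrom⇒Falling (Rising-relax w (λ { here → ℕₚ.≤-refl }) , here)
  in σ , (y , d) , eq

-- Deletes the maximum from second place for all first entries at once, so h(n+1, 1) counts the
-- avoiders of length n + 1 without an ascent below the first entry.
card-Rising⇒FallingFirst : ∀ {n m} → Card (Rising (suc n) 1 0) m → Card (FallingFirst n) m
card-Rising⇒FallingFirst {n} = card-map removeSecond forward injective backward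
  where
  forward : ∀ {τ} → Rising (suc n) 1 0 τ → FallingFirst n (removeSecond τ)
  forward w with Rising⇒FallingFirst w
  ... | σ , e , refl = subst (FallingFirst n) (sym (removeSecond-insertSecond _ σ)) e
  injective : ∀ {τ τ′} → Rising (suc n) 1 0 τ → Rising (suc n) 1 0 τ′ →
              removeSecond τ ≡ removeSecond τ′ → τ ≡ τ′
  injective w w′ eq with Rising⇒FallingFirst w | Rising⇒FallingFirst w′
  ... | σ , _ , refl | σ′ , _ , refl = cong (insertSecond (suc n))
    (trans (sym (removeSecond-insertSecond _ σ)) (trans eq (removeSecond-insertSecond _ σ′)))
  backward : ∀ {σ} → FallingFirst n σ → ∃ λ τ → Rising (suc n) 1 0 τ × removeSecond τ ≡ σ
  backward {σ} (_ , d) = _ , Rising-relax (proj₁ (Falling⇒RisingFrom d)) (λ _ → z≤n) , removeSecond-insertSecond _ σ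

-- The increasing enumeration of the naturals other than `r`; it frees the value `r` for a new
-- entry.
bump : ℕ → ℕ → ℕ
bump r a with a ℕₚ.<? r
... | yes _ = a
... | no  _ = suc a

bump-< : ∀ {r a} → a < r → bump r a ≡ a
bump-< {r} {a} a<r with a ℕₚ.<? r
... | yes _   = refl
... | no  a≮r = contradiction a<r a≮r

bump-≥ : ∀ {r a} → r ≤ a → bump r a ≡ suc a
bump-≥ {r} {a} r≤a with a ℕₚ.<? r
... | yes a<r = contradiction r≤a (ℕₚ.<⇒≱ a<r)
... | no  _   = refl

a≤bump : ∀ r a → a ≤ bump r a
a≤bump r a with a ℕₚ.<? r
... | yes _ = ℕₚ.≤-refl
... | no  _ = ℕₚ.n≤1+n a

bump≤1+a : ∀ r a → bump r a ≤ suc a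
bump≤1+a r a with a ℕₚ.<? r
... | yes _ = ℕₚ.n≤1+n a
... | no  _ = ℕₚ.≤-refl

bump-mono : ∀ r → Monotone (bump r)
bump-mono r {a} {b} a<b with a ℕₚ.<? r | b ℕₚ.<? r
... | yes _   | yes _   = a<b
... | yes _   | no  _   = ℕₚ.m<n⇒m<1+n a<b
... | no  a≮r | yes b<r = contradiction (ℕₚ.<-trans a<b b<r) a≮r
... | no  _   | no  _   = s<s a<b

bump≢r : ∀ r a → bump r a ≢ r
bump≢r r a eq with a ℕₚ.<? r
... | yes a<r = ℕₚ.<-irrefl eq a<r
... | no  a≮r = a≮r (ℕₚ.≤-reflexive eq)

r<bump⇒r≤a : ∀ {r a} → r < bump r a → r ≤ a
r<bump⇒r≤a {r} {a} lt = ℕ.s≤s⁻¹ (ℕₚ.≤-trans lt (bump≤1+a r a))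

r≤a⇒r<bump : ∀ {r a} → r ≤ a → r < bump r a
r≤a⇒r<bump r≤a = subst (_ <_) (sym (bump-≥ r≤a)) (s≤s r≤a)

unbump : ∀ {r a} → a ≢ r → ∃ λ b → bump r b ≡ a
unbump {r} {a} a≢r with ℕₚ.<-cmp a r
... | tri< a<r _ _ = a , bump-< a<r
... | tri≈ _ e _   = contradiction e a≢r
unbump {a = suc b} _ | tri> _ _ r<a = b , bump-≥ (ℕ.s≤s⁻¹ r<a)

unbump-all : ∀ {r σ} → All (r ≢_) σ → ∃ λ τ → map (bump r) τ ≡ σ
unbump-all []          = [] , refl
unbump-all (r≢a ∷ r∉)  =
  let b , e = unbump (r≢a ∘ sym) ; τ , es = unbump-all r∉ in b ∷ τ , cong₂ _∷_ e es

consBump : ℕ → List ℕ → List ℕ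
consBump r τ = r ∷ map (bump r) τ

consBump-perm : ∀ {n r τ} → r ≤ n → IsPerm n τ → IsPerm (suc n) (consBump r τ)
consBump-perm {n} {r} {τ} r≤n (len , uniq , bound) =
  cong suc (trans (Listₚ.length-map (bump r) τ) len) ,
  All.tabulate (λ b∈ r≡b → let a , _ , e = ∈-map⁻ (bump r) b∈ in bump≢r r a (sym (trans r≡b e)))
    ∷ Uniqueₚ.map⁺ (monotone-injective (bump-mono r)) uniq ,
  s≤s r≤n ∷ All.tabulate (λ b∈ → let a , a∈ , e = ∈-map⁻ (bump r) b∈ in
    subst (_< suc n) (sym e) (s≤s (ℕₚ.≤-trans (bump≤1+a r a) (All.lookup bound a∈))))

consBump-perm⁻ : ∀ {n r τ} → IsPerm (suc n) (consBump r τ) → IsPerm n τ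
consBump-perm⁻ {n} {r} {τ} perm@(len , _ ∷ uniq , r≤n ∷ bound) =
  ℕₚ.suc-injective (trans (cong suc (sym (Listₚ.length-map (bump r) τ))) len) ,
  Uniqueₚ.map⁻ uniq ,
  All.tabulate (λ {a} a∈ → small a (All.lookup bound (∈-map⁺ (bump r) a∈)))
  where
  small : ∀ a → bump r a < suc n → a < n
  small a lt with a ℕₚ.<? r
  ... | yes a<r = ℕₚ.<-≤-trans a<r (ℕ.s≤s⁻¹ r≤n)
  ... | no  _   = ℕ.s≤s⁻¹ lt

-- An ascent below the first entry would form 3412 together with that
-- entry and the maximum.
Rising-no-ascent : ∀ {n k r σ y i j a b} → Rising n (suc k) r σ → At σ 0 y →
              i < j → At σ i a → At σ j b → b < y → ¬ a < b
Rising-no-ascent {k = k} {i = i} w first i<j p q b<y a<b with i ℕₚ.≤? suc k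
... | no  i≰k = Rising.avoid w z<s (ℕₚ.≰⇒> i≰k) i<j first (Rising.top w) p q
  (bad-3412 a<b b<y (Rising.incr w z<s ℕₚ.≤-refl first (Rising.top w)))
Rising-no-ascent {i = zero} w first i<j p q b<y a<b | yes _ =
  ℕₚ.<-asym b<y (subst (_< _) (At-functional p first) a<b)
Rising-no-ascent {i = suc _} w first i<j p q b<y a<b | yes i≤k =
  ℕₚ.<-asym (ℕₚ.<-trans a<b b<y) (Rising.incr w z<s i≤k first p)

-- 3142 or 3412 starting with the new entry r would have an ascent below
-- r; in 2143 the old first entry can replace r.
consBump-Av : ∀ {n k r τ} → Rising n (suc k) r τ → Av (consBump r τ)
consBump-Av {τ = []} w _ _ _ _ (there ())
consBump-Av {r = r} {y ∷ τ} w = go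
  where
  open Rising w
  r≤y : r ≤ y
  r≤y = low here
  below : ∀ {d} → bump r d < r → d < r
  below = ℕₚ.≤-<-trans (a≤bump r _)
  mono = bump-mono r
  new-2143 : ∀ {j k l b c d} → j < k → k < l → At (y ∷ τ) j b → At (y ∷ τ) k c → At (y ∷ τ) l d →
             b < r → r ≤ d → ¬ d < c
  new-2143 {j} {d = d} j<k k<l q u v b<r r≤d d<c with ℕₚ.<-cmp d y
  ... | tri< d<y _ _ = Rising-no-ascent w here (ℕₚ.<-trans j<k k<l) q v d<y (ℕₚ.<-≤-trans b<r r≤d)
  ... | tri≈ _ refl _ = contradiction (perm-injective perm v here)
                                      (ℕₚ.<⇒≢ (ℕₚ.≤-<-trans z≤n k<l) ∘ sym)
  new-2143 {zero} _ _ here _ _ b<r _ _ | tri> _ _ _ = ℕₚ.<⇒≱ b<r r≤y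
  new-2143 {suc j} j<k k<l q u v b<r r≤d d<c | tri> _ _ y<d =
    avoid z<s j<k k<l here q u v (bad-2143 (ℕₚ.<-≤-trans b<r r≤y) y<d d<c)
  go : Av (consBump r (y ∷ τ))
  go (s≤s i<j) (s≤s j<k) (s≤s k<l) (there p) (there q) (there u) (there v) =
    Av-map⁺ mono avoid i<j j<k k<l p q u v
  go (s≤s _) (s≤s j<k) (s≤s k<l) here (there q) (there u) (there v) bad
    with At-map⁻ (bump r) (y ∷ τ) q | At-map⁻ (bump r) (y ∷ τ) u | At-map⁻ (bump r) (y ∷ τ) v
  ... | b , q′ , refl | c , u′ , refl | d , v′ , refl with bad
  ...   | bad-2143 b<r r<d d<c =
    new-2143 j<k k<l q′ u′ v′ (below b<r) (r<bump⇒r≤a r<d) (monotone-reflects mono d<c)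
  ...   | bad-3142 b<d d<r _ =
    Rising-no-ascent w here (ℕₚ.<-trans j<k k<l) q′ v′ (ℕₚ.<-≤-trans (below d<r) r≤y)
      (monotone-reflects mono b<d)
  ...   | bad-3412 c<d d<r _ =
    Rising-no-ascent w here k<l u′ v′ (ℕₚ.<-≤-trans (below d<r) r≤y) (monotone-reflects mono c<d)

-- As every entry of the run is at least `r`, `bump` lifts it above the new first entry. The bound
-- carried by `Rising` is thus exactly what lets the run be extended to the left by `r`.
Rising⇒RisingFrom : ∀ {n k r τ} → Rising n (suc k) r τ → RisingFrom (suc n) (suc (suc k)) r (consBump r τ)
Rising⇒RisingFrom {n} {k} {r} {[]} w with Rising.top w
... | ()
Rising⇒RisingFrom {n} {k} {r} {y ∷ τ} w = record
  { perm  = consBump-perm (ℕₚ.m≤n⇒m≤1+n r≤n) perm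
  ; avoid = consBump-Av w
  ; top   = there (subst (At _ (suc k)) (bump-≥ r≤n) (At-map⁺ (bump r) top))
  ; incr  = incr′
  ; low   = λ { here → ℕₚ.≤-refl }
  } , here
  where
  open Rising w
  r≤n : r ≤ n
  r≤n = ℕₚ.≤-trans (low here) (ℕ.s≤s⁻¹ (perm-value< perm here))
  incr′ : ∀ {i j a b} → i < j → j ≤ suc (suc k) →
          At (consBump r (y ∷ τ)) i a → At (consBump r (y ∷ τ)) j b → a < b
  incr′ (s≤s i<j) (s≤s j≤k) (there p) (there q)
    with At-map⁻ (bump r) (y ∷ τ) p | At-map⁻ (bump r) (y ∷ τ) q
  ... | a , p′ , refl | b , q′ , refl = bump-mono r (incr i<j j≤k p′ q′)
  incr′ {j = suc zero} _ _ here (there here) = r≤a⇒r<bump (low here)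
  incr′ {j = suc (suc j)} _ (s≤s j≤k) here (there q) with At-map⁻ (bump r) (y ∷ τ) q
  ... | b , q′ , refl = r≤a⇒r<bump (ℕₚ.≤-trans (low here) (ℕₚ.<⇒≤ (incr z<s j≤k here q′)))

RisingFrom⇒Rising : ∀ {n k r σ} → RisingFrom (suc n) (suc (suc k)) r σ →
               ∃ λ τ → Rising n (suc k) r τ × consBump r τ ≡ σ
RisingFrom⇒Rising {n} {k} {r} {_ ∷ ρ} (w , here) with Rising.perm w
... | _ , r∉ ∷ _ , _ with unbump-all r∉
... | τ , refl = τ , record
  { perm  = perm′
  ; avoid = Av-embed suc (bump r) s<s (bump-mono r) embed avoid
  ; top   = top′
  ; incr  = λ i<j j≤k p q → monotone-reflects (bump-mono r) (incr (s<s i<j) (s≤s j≤k) (embed p) (embed q))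
  ; low   = λ p → r<bump⇒r≤a (incr z<s (s≤s z≤n) here (embed p))
  } , refl
  where
  open Rising w
  perm′ : IsPerm (suc n) τ
  perm′ = consBump-perm⁻ perm
  embed : ∀ {i a} → At τ i a → At (consBump r τ) (suc i) (bump r a)
  embed p = there (At-map⁺ (bump r) p)
  top′ : At τ (suc k) n
  top′ with top
  ... | there p with At-map⁻ (bump r) τ p
  ... | t , p′ , eq = subst (At τ (suc k)) (ℕₚ.suc-injective (trans (sym (bump-≥ r≤t)) eq)) p′
    where
    r≤t : r ≤ t
    r≤t = r<bump⇒r≤a (subst (r <_) (sym eq) (incr z<s ℕₚ.≤-refl here top))

card-Rising⇒RisingFrom : ∀ {n k r m} → Card (Rising n (suc k) r) m → Card (RisingFrom (suc n) (suc (suc k)) r) m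
card-Rising⇒RisingFrom {r = r} = card-map (consBump r) Rising⇒RisingFrom
  (λ _ _ eq → Listₚ.map-injective (monotone-injective (bump-mono r)) (Listₚ.∷-injectiveʳ eq)) RisingFrom⇒Rising

-- Avoiders with an ascent below the first entry.

data Violation (σ : List ℕ) (Q : ℕ → ℕ → Set) : Set where
  violation : ∀ {i j a b} → i < j → At σ i a → At σ j b → ¬ Q a b → Violation σ Q

-- Returns a failing pair explicitly, since such pairs are what ascents are built from.
search : ∀ σ {Q : ℕ → ℕ → Set} → (∀ a b → Dec (Q a b)) →
         (∀ {i j a b} → i < j → At σ i a → At σ j b → Q a b) ⊎ Violation σ Q
search []      Q? = inj₁ λ _ ()
search (x ∷ σ) {Q} Q? with All.all? (Q? x) σ | search σ Q?
... | yes Qx | inj₁ Qσ = inj₁ holds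
  where
  holds : ∀ {i j a b} → i < j → At (x ∷ σ) i a → At (x ∷ σ) j b → Q a b
  holds _         here      (there q) = All.lookup Qx (At⇒∈ q)
  holds (s≤s i<j) (there p) (there q) = Qσ i<j p q
... | no ¬Qx | _ = let b , b∈ , ¬q = find (Allₚ.¬All⇒Any¬ (Q? x) σ ¬Qx)
                       j , q = ∈⇒At b∈
                   in inj₂ (violation z<s here (there q) ¬q)
... | yes _  | inj₂ (violation i<j p q ¬q) = inj₂ (violation (s<s i<j) (there p) (there q) ¬q)

Decreasing : Pred
Decreasing σ = ∀ {i j a b} → i < j → At σ i a → At σ j b → b < a

decreasing? : Decidable Decreasing
decreasing? σ with search σ (λ a b → b ℕₚ.<? a)
... | inj₁ dec                   = yes dec
... | inj₂ (violation i<j p q ¬d) = no λ dec → ¬d (dec i<j p q)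

data AscentBelowFirst (σ : List ℕ) : Set where
  ascent : ∀ {f i j a b} → At σ 0 f → i < j → At σ i a → At σ j b → a < b → b < f →
           AscentBelowFirst σ

Ascent : ℕ → Pred
Ascent n σ = Avoider n σ × AscentBelowFirst σ

-- The maximum of a permutation of length `n` is n - 1, whence `suc f ≢ n`.
Ascent′ : ℕ → Pred
Ascent′ n σ = Ascent n σ × (∀ {f} → At σ 0 f → suc f ≢ n)

perm-≮⇒> : ∀ {n σ i j a b} → IsPerm n σ → i < j → At σ i a → At σ j b → ¬ b < a → a < b
perm-≮⇒> perm i<j p q b≮a =
  ℕₚ.≤∧≢⇒< (ℕₚ.≮⇒≥ b≮a) λ { refl → ℕₚ.<-irrefl (perm-injective perm p q) i<j }

FallingFirst⊎Ascent : ∀ {n σ} → Avoider (suc n) σ → FallingFirst n σ ⊎ Ascent (suc n) σ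
FallingFirst⊎Ascent {σ = f ∷ σ} s@(perm , av) with search (f ∷ σ) (λ a b → (b ℕₚ.<? f) →-dec (b ℕₚ.<? a))
... | inj₁ decr = inj₁ (f , record { perm = perm ; avoid = av ; first = here ; decr = decr })
... | inj₂ (violation {b = b} i<j p q ¬d) with b ℕₚ.<? f
...   | yes b<f = inj₂ (s , ascent here i<j p q (perm-≮⇒> perm i<j p q λ b<a → ¬d λ _ → b<a) b<f)
...   | no  b≮f = contradiction (λ b<f → contradiction b<f b≮f) ¬d

FallingFirst∩Ascent : ∀ {n σ} → FallingFirst n σ → ¬ Ascent (suc n) σ
FallingFirst∩Ascent (r , d) (_ , ascent first i<j p q a<b b<f) =
  ℕₚ.<-asym a<b (Falling.decr d i<j p q (subst (_ <_) (At-functional first (Falling.first d)) b<f))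

card-FallingFirst⊎Ascent⇒Avoider : ∀ {n k l} →
  Card (FallingFirst n) k → Card (Ascent (suc n)) l → Card (Avoider (suc n)) (k + l)
card-FallingFirst⊎Ascent⇒Avoider cE cC = card-cong
  [ (λ (_ , d) → Falling.perm d , Falling.avoid d) , proj₁ ]′ FallingFirst⊎Ascent
  (card-⊎ FallingFirst∩Ascent cE cC)

-- A nonempty decreasing permutation starts with its maximum, and a leading maximum does not affect
-- avoidance.
card-decreasing : ∀ n → Card (λ σ → Avoider n σ × Decreasing σ) 1
card-decreasing zero =
  ([] ∷ []) , ([] ∷ []) ,
  (λ σ → mk⇔ (λ { (here refl) → ((refl , [] , []) , λ _ _ _ ()) , λ _ () })
             (λ { (((len , _) , _) , _) → here (length≡0 len) })) ,
  refl
  where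
  length≡0 : ∀ {σ : List ℕ} → length σ ≡ 0 → σ ≡ []
  length≡0 {[]} _ = refl
card-decreasing (suc n) = card-map (n ∷_) forward (λ _ _ → Listₚ.∷-injectiveʳ) backward (card-decreasing n)
  where
  forward : ∀ {σ} → Avoider n σ × Decreasing σ → Avoider (suc n) (n ∷ σ) × Decreasing (n ∷ σ)
  forward {σ} (s , dec) = Avoider-∷-max s , dec′
    where
    dec′ : Decreasing (n ∷ σ)
    dec′ _         here      (there q) = perm-value< (proj₁ s) q
    dec′ (s≤s i<j) (there p) (there q) = dec i<j p q
  backward : ∀ {τ} → Avoider (suc n) τ × Decreasing τ → ∃ λ σ → (Avoider n σ × Decreasing σ) × n ∷ σ ≡ τ
  backward {x ∷ σ} (s@(perm , _) , dec) with perm-surjective perm (ℕₚ.≤-refl {suc n})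
  ... | zero  , here = σ , (Avoider-∷-max⁻ s , λ i<j p q → dec (s<s i<j) (there p) (there q)) , refl
  ... | suc i , p    = contradiction (dec z<s here p) (ℕₚ.≤⇒≯ (ℕ.s≤s⁻¹ (perm-value< perm here)))

-- Behind a leading maximum every ascent lies below the first entry, so the only avoider excluded
-- for the rest is the decreasing one. This is the source of `∸ 1`.
card-Ascent-lead : ∀ {n k} → Card (Avoider n) k → Card (λ σ → Ascent (suc n) σ × At σ 0 n) (k ∸ 1)
card-Ascent-lead {n} cS = card-map (n ∷_) forward (λ _ _ → Listₚ.∷-injectiveʳ) backward
                              (card-∖ decreasing? cS (card-decreasing n))
  where
  forward : ∀ {σ} → Avoider n σ × ¬ Decreasing σ → Ascent (suc n) (n ∷ σ) × At (n ∷ σ) 0 n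
  forward {σ} (s@(perm , _) , ¬dec) with search σ (λ a b → b ℕₚ.<? a)
  ... | inj₁ dec = contradiction (λ {_ _ _ _} → dec) ¬dec
  ... | inj₂ (violation i<j p q ¬d) =
    (Avoider-∷-max s , ascent here (s<s i<j) (there p) (there q) (perm-≮⇒> perm i<j p q ¬d)
                                                  (perm-value< perm q)) , here
  backward : ∀ {τ} → Ascent (suc n) τ × At τ 0 n → ∃ λ σ → (Avoider n σ × ¬ Decreasing σ) × n ∷ σ ≡ τ
  backward ((s , ascent here (s≤s i<j) (there p) (there q) a<b _) , here) =
    _ , (Avoider-∷-max⁻ s , λ dec → ℕₚ.<-asym a<b (dec i<j p q)) , refl
  backward ((s , ascent here _ here (there q) n<b b<n) , here) = contradiction b<n (ℕₚ.<-asym n<b)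

card-Ascent-suc : ∀ {n k l} → Card (Avoider n) k → Card (Ascent′ (suc n)) l → Card (Ascent (suc n)) ((k ∸ 1) + l)
card-Ascent-suc {n} cS cC′ = card-cong [ proj₁ , proj₁ ]′ split
  (card-⊎ disjoint (card-Ascent-lead cS) cC′)
  where
  disjoint : ∀ {σ} → Ascent (suc n) σ × At σ 0 n → ¬ Ascent′ (suc n) σ
  disjoint (_ , p) (_ , lead) = lead p refl
  split : ∀ {σ} → Ascent (suc n) σ → (Ascent (suc n) σ × At σ 0 n) ⊎ Ascent′ (suc n) σ
  split {f ∷ σ} c with f ℕₚ.≟ n
  ... | yes refl = inj₁ (c , here)
  ... | no  f≢n  = inj₂ (c , λ { here e → f≢n (ℕₚ.suc-injective e) })

-- Adding and removing the last entry.

At-∷ʳ⁺ : ∀ {A : Set} {xs : List A} {y i x} → At xs i x → At (xs List.∷ʳ y) i x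
At-∷ʳ⁺ here      = here
At-∷ʳ⁺ (there p) = there (At-∷ʳ⁺ p)

At-last : ∀ {A : Set} (xs : List A) {y} → At (xs List.∷ʳ y) (length xs) y
At-last []       = here
At-last (x ∷ xs) = there (At-last xs)

At-∷ʳ⁻ : ∀ {A : Set} (xs : List A) {y i x} → At (xs List.∷ʳ y) i x →
         At xs i x ⊎ (i ≡ length xs × x ≡ y)
At-∷ʳ⁻ []       here      = inj₂ (refl , refl)
At-∷ʳ⁻ (x ∷ xs) here      = inj₁ here
At-∷ʳ⁻ (x ∷ xs) (there p) with At-∷ʳ⁻ xs p
... | inj₁ q             = inj₁ (there q)
... | inj₂ (refl , refl) = inj₂ (refl , refl)

At-∷ʳ-init : ∀ {A : Set} (xs : List A) {y i j x z} → i < j →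
             At (xs List.∷ʳ y) i x → At (xs List.∷ʳ y) j z → At xs i x
At-∷ʳ-init xs i<j p q with At-∷ʳ⁻ xs p
... | inj₁ p′         = p′
... | inj₂ (refl , _) with At-∷ʳ⁻ xs q
...   | inj₁ q′         = contradiction (At⇒< q′) (ℕₚ.<-asym i<j)
...   | inj₂ (refl , _) = contradiction i<j (ℕₚ.<-irrefl refl)

Av-∷ʳ⁺ : ∀ {σ x} → (∀ {i j k a b c} → i < j → j < k → At σ i a → At σ j b → At σ k c → ¬ Bad a b c x) →
         Av σ → Av (σ List.∷ʳ x)
Av-∷ʳ⁺ {σ} last-ok av i<j j<k k<l p q r s
  with At-∷ʳ-init σ (ℕₚ.<-trans i<j j<k) p r | At-∷ʳ-init σ j<k q r | At-∷ʳ-init σ k<l r s | At-∷ʳ⁻ σ s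
... | p′ | q′ | r′ | inj₁ s′         = av i<j j<k k<l p′ q′ r′ s′
... | p′ | q′ | r′ | inj₂ (_ , refl) = last-ok i<j j<k p′ q′ r′

Av-∷ʳ⁻ : ∀ {σ x} → Av (σ List.∷ʳ x) → Av σ
Av-∷ʳ⁻ = Av-embed id id id id At-∷ʳ⁺

perm-∷ʳ⁺ : ∀ {n σ x} → length σ ≡ n → Unique σ → All (_< suc n) σ → All (x ≢_) σ → x < suc n →
           IsPerm (suc n) (σ List.∷ʳ x)
perm-∷ʳ⁺ {σ = σ} len uniq bound x∉ x≤n =
  trans (Listₚ.length-++ σ) (trans (ℕₚ.+-comm _ 1) (cong suc len)) ,
  Uniqueₚ.++⁺ uniq ([] ∷ []) (λ { (a∈ , here refl) → All.lookup x∉ a∈ refl }) ,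
  Allₚ.++⁺ bound (x≤n ∷ [])

perm-∷ʳ⁻ : ∀ {n σ x} → IsPerm (suc n) (σ List.∷ʳ x) →
           length σ ≡ n × Unique σ × All (_< suc n) σ × All (x ≢_) σ
perm-∷ʳ⁻ {n} {σ} {x} perm@(len , _ , bound) =
  ℕₚ.suc-injective (trans (sym (trans (Listₚ.length-++ σ) (ℕₚ.+-comm _ 1))) len) ,
  At-injective⇒unique (λ p q → perm-injective perm (At-∷ʳ⁺ p) (At-∷ʳ⁺ q)) ,
  Allₚ.++⁻ˡ σ bound ,
  All.tabulate (λ { a∈ refl → let _ , p = ∈⇒At a∈ in
    ℕₚ.<-irrefl (perm-injective perm (At-∷ʳ⁺ p) (At-last σ)) (At⇒< p) })

-- No pattern in T ends with its largest letter, so a final maximum is harmless; it also keeps the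
-- first entry from being the maximum.
Ascent⇒Ascent′-∷ʳ-max : ∀ {n σ} → Ascent n σ → Ascent′ (suc n) (σ List.∷ʳ n)
Ascent⇒Ascent′-∷ʳ-max {n} {σ} ((perm@(len , uniq , bound) , av) , ascent first i<j p q a<b b<f) =
  ( ( perm-∷ʳ⁺ len uniq (All.map ℕₚ.m<n⇒m<1+n bound) (All.map (λ a<n → ℕₚ.<⇒≢ a<n ∘ sym) bound) ℕₚ.≤-refl
    , Av-∷ʳ⁺ last-ok av )
  , ascent (At-∷ʳ⁺ first) i<j (At-∷ʳ⁺ p) (At-∷ʳ⁺ q) a<b b<f ) ,
  λ first′ e → ℕₚ.<⇒≢ (perm-value< perm first)
                      (trans (At-functional (At-∷ʳ⁺ first) first′) (ℕₚ.suc-injective e))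
  where
  last-ok : ∀ {i j k a b c} → i < j → j < k → At σ i a → At σ j b → At σ k c → ¬ Bad a b c n
  last-ok _ _ _ _ r (bad-2143 _ _ n<c) = ℕₚ.<-asym n<c (perm-value< perm r)
  last-ok _ _ p _ _ (bad-3142 _ n<a _) = ℕₚ.<-asym n<a (perm-value< perm p)
  last-ok _ _ p _ _ (bad-3412 _ n<a _) = ℕₚ.<-asym n<a (perm-value< perm p)

-- Once `n` is removed the first entry may be the new maximum, hence `Ascent` and not `Ascent′` in
-- the conclusion.
Ascent′-∷ʳ-max⇒Ascent : ∀ {n σ} → Ascent′ (suc n) (σ List.∷ʳ n) → Ascent n σ
Ascent′-∷ʳ-max⇒Ascent {n} {σ} (((perm , av) , ascent first i<j p q a<b b<f) , _) with perm-∷ʳ⁻ perm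
... | len , uniq , bound , n∉ =
  ((len , uniq , all<∧≢ bound n∉) , Av-∷ʳ⁻ av) ,
  ascent (At-∷ʳ-init σ (ℕₚ.≤-<-trans z≤n i<j) first q) i<j (At-∷ʳ-init σ i<j p q) q′ a<b b<f
  where
  q′ : At σ _ _
  q′ with At-∷ʳ⁻ σ q
  ... | inj₁ q″         = q″
  ... | inj₂ (_ , refl) = contradiction b<f (ℕₚ.≤⇒≯ (ℕ.s≤s⁻¹ (perm-value< perm first)))

-- No pattern in T ends with its smallest letter, so a final minimum is harmless; shifting the
-- values keeps the first entry away from the maximum.
Ascent′⇒Ascent′-∷ʳ-zero : ∀ {n σ} → Ascent′ n σ → Ascent′ (suc n) (map suc σ List.∷ʳ 0)
Ascent′⇒Ascent′-∷ʳ-zero {n} {σ} ((((len , uniq , bound) , av) , ascent first i<j p q a<b b<f) , lead) =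
  ( ( perm-∷ʳ⁺ (trans (Listₚ.length-map suc σ) len)
               (Uniqueₚ.map⁺ ℕₚ.suc-injective uniq)
               (Allₚ.map⁺ (All.map s<s bound))
               (Allₚ.map⁺ (All.map (λ _ ()) bound))
               z<s
    , Av-∷ʳ⁺ (λ { _ _ _ _ _ (bad-2143 _ () _)
                ; _ _ _ _ _ (bad-3142 () _ _)
                ; _ _ _ _ _ (bad-3412 () _ _) }) (Av-map⁺ s<s av) )
  , ascent (lift first) i<j (lift p) (lift q) (s<s a<b) (s<s b<f) ) ,
  λ first′ e → lead first (trans (At-functional (lift first) first′) (ℕₚ.suc-injective e))
  where
  lift : ∀ {i a} → At σ i a → At (map suc σ List.∷ʳ 0) i (suc a)
  lift p = At-∷ʳ⁺ (At-map⁺ suc p)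

all-suc : ∀ {σ} → All (0 ≢_) σ → ∃ λ τ → map suc τ ≡ σ
all-suc []                    = [] , refl
all-suc {zero ∷ _} (0≢0 ∷ _)  = contradiction refl 0≢0
all-suc {suc a ∷ _} (_ ∷ 0∉)  = let τ , e = all-suc 0∉ in a ∷ τ , cong (suc a ∷_) e

Ascent′-∷ʳ-zero⇒Ascent′ : ∀ {n σ} → Ascent′ (suc n) (σ List.∷ʳ 0) → ∃ λ τ → Ascent′ n τ × map suc τ ≡ σ
Ascent′-∷ʳ-zero⇒Ascent′ {n} (((perm , av) , asc) , lead) with perm-∷ʳ⁻ perm
... | len , uniq , bound , 0∉ with all-suc 0∉
...   | τ , refl = τ ,
  ( ( ( ( trans (sym (Listₚ.length-map suc τ)) len
        , Uniqueₚ.map⁻ uniq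
        , All.map ℕ.s<s⁻¹ (Allₚ.map⁻ bound) )
      , Av-embed id suc id s<s (λ p → At-∷ʳ⁺ (At-map⁺ suc p)) av )
    , lower asc )
  , λ p e → lead (At-∷ʳ⁺ (At-map⁺ suc p)) (cong suc e) ) , refl
  where
  drop : ∀ {i a} → At (map suc τ List.∷ʳ 0) i a → 0 < a → ∃ λ b → At τ i b × suc b ≡ a
  drop p 0<a with At-∷ʳ⁻ (map suc τ) p
  ... | inj₁ p′         = At-map⁻ suc τ p′
  ... | inj₂ (_ , refl) = contradiction 0<a λ ()
  lower : AscentBelowFirst (map suc τ List.∷ʳ 0) → AscentBelowFirst τ
  lower (ascent first i<j p q a<b b<f)
    -- None of the three entries is the final 0: something lies below `f` and below `b`, and `a`
    -- stands to the left of `b`.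
    with drop first (ℕₚ.≤-<-trans z≤n b<f) | At-map⁻ suc τ (At-tail p q i<j) | drop q (ℕₚ.≤-<-trans z≤n a<b)
    where
    At-tail : ∀ {i j a b} → At (map suc τ List.∷ʳ 0) i a → At (map suc τ List.∷ʳ 0) j b → i < j →
              At (map suc τ) i a
    At-tail p q i<j = At-∷ʳ-init (map suc τ) i<j p q
  ... | _ , first′ , refl | _ , p′ , refl | _ , q′ , refl =
    ascent first′ i<j p′ q′ (ℕ.s<s⁻¹ a<b) (ℕ.s<s⁻¹ b<f)

-- The ascent a < b below the first entry f forces the maximum n to its
-- right, and then any last entry l other than n and 0 completes 2143,
-- 3142 or 3412: with f a n if a < l, and with f, n and 0 otherwise.
Ascent′-last : ∀ {n σ l} → Ascent′ (suc n) (σ List.∷ʳ l) → l ≡ n ⊎ l ≡ 0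
Ascent′-last {n} {σ} {l} (((perm , av) , ascent {f} {i} {j} {a} {b} first i<j p q a<b b<f) , lead)
  with l ℕₚ.≟ n | l ℕₚ.≟ 0
... | yes l≡n | _       = inj₁ l≡n
... | no  _   | yes l≡0 = inj₂ l≡0
... | no  l≢n | no  l≢0 = ⊥-elim impossible
  where
  last = At-last σ {l}
  ≤n : ∀ {i x} → At (σ List.∷ʳ l) i x → x ≤ n
  ≤n p = ℕ.s≤s⁻¹ (perm-value< perm p)
  l<n : l < n
  l<n = ℕₚ.≤∧≢⇒< (≤n last) l≢n
  f<n : f < n
  f<n = ℕₚ.≤∧≢⇒< (≤n first) (lead first ∘ cong suc)
  a<f = ℕₚ.<-trans a<b b<f
  before-last : ∀ {i x} → At (σ List.∷ʳ l) i x → x ≢ l → i < length σ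
  before-last p x≢l with At-∷ʳ⁻ σ p
  ... | inj₁ p′         = At⇒< p′
  ... | inj₂ (_ , x≡l) = contradiction x≡l x≢l
  after-first : ∀ {i x} → At (σ List.∷ʳ l) i x → x ≢ f → 0 < i
  after-first p x≢f = ℕₚ.n≢0⇒n>0 λ { refl → x≢f (At-functional p first) }
  at-max  = perm-surjective perm (ℕₚ.≤-refl {suc n})
  m       = proj₁ at-max
  max     = proj₂ at-max
  at-zero = perm-surjective perm (z<s {n})
  z       = proj₁ at-zero
  nil     = proj₂ at-zero
  0<m : 0 < m
  0<m = after-first max (ℕₚ.<⇒≢ f<n ∘ sym)
  m<L : m < length σ
  m<L = before-last max (l≢n ∘ sym)
  i<m : i < m
  i<m with ℕₚ.<-cmp i m
  ... | tri< lt _ _   = lt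
  ... | tri≈ _ refl _ = contradiction (At-functional p max) (ℕₚ.<⇒≢ (ℕₚ.<-trans a<f f<n))
  ... | tri> _ _ m<i  = ⊥-elim (av 0<m m<i i<j first max p q (bad-3412 a<b b<f f<n))
  0<i : 0 < i
  0<i = after-first p (ℕₚ.<⇒≢ a<f)
  impossible : ⊥
  impossible with ℕₚ.<-cmp f l | ℕₚ.<-cmp a l | ℕₚ.<-cmp z m
  ... | tri< f<l _ _  | _ | _ = av 0<i i<m m<L first p max last (bad-2143 a<f f<l l<n)
  ... | tri≈ _ refl _ | _ | _ = ℕₚ.<-irrefl (perm-injective perm first last) (ℕₚ.<-trans 0<m m<L)
  ... | tri> _ _ l<f | tri< a<l _ _  | _ = av 0<i i<m m<L first p max last (bad-3142 a<l l<f f<n)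
  ... | tri> _ _ l<f | tri≈ _ refl _ | _ = ℕₚ.<-irrefl (perm-injective perm p last) (ℕₚ.<-trans i<m m<L)
  ... | tri> _ _ l<f | tri> _ _ l<a | tri< z<m _ _ =
    av (after-first nil (ℕₚ.<⇒≢ (ℕₚ.≤-<-trans z≤n b<f))) z<m m<L first nil max last
       (bad-3142 (ℕₚ.n≢0⇒n>0 l≢0) l<f f<n)
  ... | tri> _ _ l<f | tri> _ _ l<a | tri≈ _ z≡m _ =
    ℕₚ.<⇒≢ (ℕₚ.≤-<-trans z≤n f<n) (At-functional nil (subst (λ k → At _ k n) (sym z≡m) max))
  ... | tri> _ _ l<f | tri> _ _ l<a | tri> _ _ m<z =
    av 0<m m<z (before-last nil (l≢0 ∘ sym)) first max nil last
       (bad-3412 (ℕₚ.n≢0⇒n>0 l≢0) l<f f<n)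

Image : (List ℕ → List ℕ) → Pred → Pred
Image f P τ = ∃ λ σ → P σ × f σ ≡ τ

card-image : ∀ {f P k} → (∀ {σ τ} → P σ → P τ → f σ ≡ f τ → σ ≡ τ) → Card P k → Card (Image f P) k
card-image inj = card-map _ (λ p → _ , p , refl) inj id

card-Ascent′-suc : ∀ {n k l} → Card (Ascent n) k → Card (Ascent′ n) l → Card (Ascent′ (suc n)) (k + l)
card-Ascent′-suc {n} cC cC′ = card-cong [ forward-max , forward-zero ]′ split
  (card-⊎ disjoint (card-image (λ _ _ → Listₚ.∷ʳ-injectiveˡ _ _) cC)
                   (card-image (λ _ _ eq → Listₚ.map-injective ℕₚ.suc-injective (Listₚ.∷ʳ-injectiveˡ _ _ eq)) cC′))
  where
  EndsMax EndsZero : Pred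
  EndsMax  = Image (List._∷ʳ n) (Ascent n)
  EndsZero = Image (λ σ → map suc σ List.∷ʳ 0) (Ascent′ n)
  forward-max : ∀ {σ} → EndsMax σ → Ascent′ (suc n) σ
  forward-max (_ , c , refl) = Ascent⇒Ascent′-∷ʳ-max c
  forward-zero : ∀ {σ} → EndsZero σ → Ascent′ (suc n) σ
  forward-zero (_ , c , refl) = Ascent′⇒Ascent′-∷ʳ-zero c
  disjoint : ∀ {σ} → EndsMax σ → ¬ EndsZero σ
  disjoint (τ , ((perm , _) , ascent p _ _ _ _ _) , refl) (_ , _ , eq) =
    -- `τ` is nonempty because it has an ascent, so `n` is positive and the two endings differ.
    ℕₚ.<⇒≢ (ℕₚ.≤-<-trans z≤n (perm-value< perm p)) (Listₚ.∷ʳ-injectiveʳ _ _ eq)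
  split : ∀ {σ} → Ascent′ (suc n) σ → EndsMax σ ⊎ EndsZero σ
  split {σ} c with initLast σ
  split (((((() , _)) , _) , _) , _) | []
  ... | τ ∷ʳ′ l with Ascent′-last {σ = τ} c
  ...   | inj₁ refl = inj₁ (τ , Ascent′-∷ʳ-max⇒Ascent c , refl)
  ...   | inj₂ refl with Ascent′-∷ʳ-zero⇒Ascent′ {σ = τ} c
  ...     | τ′ , c′ , refl = inj₂ (τ′ , c′ , refl)

-- Assembly of the counts.

-- The run starts at `r` or above and gains at least one at each of the `k` steps to the maximum.
-- This is where the downward induction on `r` starts.
Rising-bound : ∀ {n k r σ} → Rising n k r σ → k + r ≤ n
Rising-bound {n} {k} {r} {σ} w = climb k ℕₚ.≤-refl top
  where
  open Rising w
  k≤n : k ≤ n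
  k≤n = ℕ.s≤s⁻¹ (perm-index< perm top)
  climb : ∀ i {a} → i ≤ k → At σ i a → i + r ≤ a
  climb zero    _     p = low p
  climb (suc i) i<k   p =
    let b , q = perm-at perm (ℕₚ.<-trans i<k (s≤s k≤n))
    in ℕₚ.≤-trans (s≤s (climb i (ℕₚ.<⇒≤ i<k) q)) (incr ℕₚ.≤-refl i<k q p)

Rising-split : ∀ {n k r σ} → Rising n k r σ → RisingFrom n k r σ ⊎ Rising n k (suc r) σ
Rising-split {σ = []} w with Rising.top w
... | ()
Rising-split {r = r} {x ∷ σ} w with ℕₚ.m≤n⇒m<n∨m≡n (Rising.low w here)
... | inj₂ refl = inj₁ (w , here)
... | inj₁ r<x  = inj₂ (Rising-relax w λ { here → r<x })

Rising-weaken : ∀ {n k r σ} → Rising n k (suc r) σ → Rising n k r σ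
Rising-weaken w = Rising-relax w λ p → ℕₚ.<⇒≤ (Rising.low w p)

card-Rising-split : ∀ {n k r l m} →
  Card (RisingFrom n k r) l → Card (Rising n k (suc r)) m → Card (Rising n k r) (l + m)
card-Rising-split cV cW = card-cong [ proj₁ , Rising-weaken ]′ Rising-split
  (card-⊎ (λ (_ , p) w → ℕₚ.<-irrefl refl (Rising.low w p)) cV cW)

mutual
  -- The number depends on `k` and `r` only through their sum. Splitting off first entry `r` gives
  -- the recurrence of `count`: raising `r` by one moves a unit from `d` to `m`. Every cycle of the
  -- mutual recursion lowers `d`, or keeps `d` and lowers `m`; for avoiders and ascents the length
  -- plays the part of `d`.
  card-Rising : ∀ d m {n k r} → n ≡ d + m → suc k + r ≡ m → Card (Rising n (suc k) r) (count d m)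
  card-Rising zero    (suc m) refl refl = card-Rising-split
    -- For `d = 0` the sum k + 1 + r already equals `n`, so `Rising-bound` excludes a larger first
    -- entry.
    (card-RisingFrom zero m refl refl) (card-∅ λ w →
    ℕₚ.<-irrefl refl (ℕₚ.≤-trans (ℕₚ.≤-reflexive (cong suc (sym (ℕₚ.+-suc _ _)))) (Rising-bound w)))
  card-Rising (suc d) (suc m) refl refl = card-Rising-split
    (card-RisingFrom (suc d) m (cong suc (ℕₚ.+-suc d m)) refl)
    (card-Rising d (suc (suc m)) (sym (ℕₚ.+-suc d (suc m))) (cong suc (ℕₚ.+-suc _ _)))

  -- If a single entry precedes the maximum, the maximum is deleted, which leaves the falling kind.
  -- A longer run loses its first entry and stays rising.
  card-RisingFrom : ∀ d m {n k r} → n ≡ suc (d + m) → k + r ≡ m → Card (RisingFrom n (suc k) r) (count d m)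
  card-RisingFrom d m       {k = zero}  refl refl = card-Falling⇒RisingFrom (card-Falling d m refl)
  card-RisingFrom d (suc m) {k = suc k} refl eq   = card-Rising⇒RisingFrom (card-Rising d (suc m) refl eq)

  -- The turn leads back to the rising kind with bound 0. For `m = 0` the maximum stands first
  -- there, and dropping it leaves an arbitrary avoider of length `d`.
  card-Falling : ∀ d m {n} → n ≡ d + m → Card (Falling n m) (count d m)
  card-Falling d zero    refl = subst (λ n → Card (Falling n 0) (count d 0)) (sym (ℕₚ.+-identityʳ d))
                                (card-rot (card-Avoider⇒Rising (card-Avoider d)))
  card-Falling d (suc m) eq   = card-rot (card-Rising d (suc m) eq (ℕₚ.+-identityʳ (suc m)))

  card-Avoider : ∀ n → Card (Avoider n) (count n 0)
  card-Avoider zero    = card-cong {P = λ σ → Avoider 0 σ × Decreasing σ} proj₁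
    (λ s → s , λ {_ _ _ _} _ p _ → contradiction (perm-index< (proj₁ s) p) λ ()) (card-decreasing 0)
  card-Avoider (suc n) = card-FallingFirst⊎Ascent⇒Avoider
    (card-Rising⇒FallingFirst (card-Rising n 1 (ℕₚ.+-comm 1 n) refl)) (card-Ascent (suc n))

  card-Ascent : ∀ n → Card (Ascent n) (asc n)
  card-Ascent zero    = card-∅ λ
    { ((perm , _) , ascent p _ _ _ _ _) → contradiction (perm-index< perm p) λ () }
  card-Ascent (suc n) = card-Ascent-suc (card-Avoider n) (card-Ascent′ (suc n))

  card-Ascent′ : ∀ n → Card (Ascent′ n) (asc′ n)
  card-Ascent′ zero    = card-∅ λ
    { (((perm , _) , ascent p _ _ _ _ _) , _) → contradiction (perm-index< perm p) λ () }
  card-Ascent′ (suc n) = card-Ascent′-suc (card-Ascent n) (card-Ascent′ n)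

theorem3p33 : Σ (ℕ → ℕ) λ a →
    (∀ n → CardSnT n (a n)) ×
    (∀ n → (ofℕ a ⊛ ((const (+ 1) ⊖ (const (+ 2) ⊛ X)) ⊖ ((X ⊛ (const (+ 1) ⊖ X)) ⊛ Cat))) n
    ≡ ((const (+ 1) ⊖ (const (+ 3) ⊛ X)) ⊛ Cat) n)
theorem3p33 = (λ n → count n 0) , (λ n → card-Avoider⇒CardSnT (card-Avoider n)) , generating-function
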